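{- Let $p$ be a prime and let $A\subset \mathbb{F}_p$ be a nonempty set with $|A|<p^{1/2}$. Then $$|A(A+1)|\ge |A|^{106/105+o(1)},$$ where $o(1)$ denotes a quantity tending to $0$ as $|A|\to\infty$, uniformly in $p$.
   Context: $\mathbb{F}_p$ is the field with $p$ elements. For sets $X,Y\subset \mathbb{F}_p$, $XY=\{xy: x\in X, y\in Y\}$ and $X+1=\{x+1: x\in X\}$; thus $A(A+1)=\{a(b+1): a,b\in A\}$. -}

module Defs where

open import Data.Nat using (ℕ; suc; _+_; _*_; NonZero)
open import Data.Nat.DivMod using (_mod_)
open import Data.Nat.Primality using (Prime; prime⇒nonZero)
open import Data.Fin using (Fin; toℕ; _≟_)
open import Data.Fin.Subset using (Subset; _∈_)
open import Data.Fin.Subset.Properties using (_∈?_)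
open import Data.Fin.Properties using (any?)
open import Data.Product using (∃; _×_)
open import Relation.Nullary.Decidable using (_×-dec_)
open import Data.Vec using (tabulate)
open import Relation.Nullary using (does)
open import Relation.Binary.PropositionalEquality using (_≡_)

-- The field F_p is modelled as Fin p (residues 0..p-1), with arithmetic mod p.
module _ {p : ℕ} (pr : Prime p) where
  private
    instance
      nz : NonZero p
      nz = prime⇒nonZero pr

  mulF : Fin p → Fin p → Fin p
  mulF x y = (toℕ x * toℕ y) mod p

  succF : Fin p → Fin p
  succF x = (toℕ x + 1) mod p

  InProdShift : Subset p → Fin p → Set
  InProdShift A x = ∃ λ a → ∃ λ b → a ∈ A × b ∈ A × x ≡ mulF a (succF b)

  prodShift : Subset p → Subset p
  prodShift A = tabulate λ x →
    does (any? λ a → any? λ b → (a ∈? A) ×-dec ((b ∈? A) ×-dec (x ≟ mulF a (succF b))))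

{-# OPTIONS --safe #-}
-- Write |A(A+1)| = K|A|, with 0 and −1 removed from A.  Plünnecke's inequality gives |AA| ≪ K²|A|.
-- The identity x + xq = x(q + 1) says that y ∈ xA implies x + y ∈ S = A(A+1); hence y − y′ has as
-- many representations in S − S as there are x ∈ A with y, y′ ∈ xA.  Double counting these x
-- produces a₀ ∈ A and P ⊆ A with |P| ≥ |A|/2 such that for p ∈ P and all but a proportion ≪ K⁻² of
-- p′ ∈ A the difference a₀p − a₀p′ is represented ≫ |A|/K⁶ times.  If aA and bA meet in ≫ |A|/K²
-- points, then a₀(ap − bz) = a(a₀p − a₀p′) + b(a₀z′ − a₀z) with ap′ = bz′ shows |aP − bP| ≪ K¹⁸|A|.
-- The multiplicative energy yields b ∈ P and P₁ ⊆ P with |P₁| ≫ |A|/K² all of whose elements a meet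
-- b in this sense.  The Glibichuk–Konyagin pivot on the ratios (a − b)/(c − d) of P₁ gives
-- |P₁|³ ≪ |P₁ − P₁| |(c − d)P₁ + (a − b)P₁|, while Plünnecke and Ruzsa bound the right-hand side by
-- K¹⁸|A| · K⁷²|A|.  Altogether |A| ≪ K⁹⁶, which is stronger than the required |A| ≤ K^(105 + o(1)).

module Submission where

open import Defs
open import Data.Nat using (ℕ; zero; suc; _+_; _*_; _∸_; _^_; _≤_; _<_; _%_; _≤?_; _<?_; z≤n; s≤s; NonZero; >-nonZero) renaming (_≟_ to _≟ℕ_)
open import Data.Nat.Primality using (Prime; prime⇒nonZero; euclidsLemma)
open import Data.Fin.Subset using (Subset; ∣_∣; Nonempty; inside; outside) renaming (_∈_ to _∈ₛ_)
open import Data.Product using (∃; ∃₂; ∃-syntax; _×_; _,_; proj₁; proj₂)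
open import Algebra.Bundles using (CommutativeRing; RawRing)
open import Algebra.Structures using (IsCommutativeRing)
import Algebra.Properties.AbelianGroup as AbelianGroupProperties
import Algebra.Properties.CommutativeSemigroup as CommutativeSemigroupProperties
import Algebra.Properties.Ring as RingProperties
import Algebra.Properties.Semiring.Mult as Mult
import Algebra.Solver.Ring as RingSolver
open import Algebra.Solver.Ring.AlmostCommutativeRing using (fromCommutativeRing; _-Raw-AlmostCommutative⟶_)
open import Data.Bool using (if_then_else_; true; false)
open import Data.Empty using (⊥-elim)
open import Data.Fin using (Fin; zero; suc; toℕ) renaming (_≟_ to _≟ᶠ_)
open import Data.Fin.Properties using (toℕ-injective; toℕ<n; toℕ-fromℕ<) renaming (suc-injective to sucᶠ-injective; any? to anyᶠ?)
open import Data.Fin.Subset.Properties using () renaming (_∈?_ to _∈ₛ?_)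
open import Data.List using (List; []; _∷_; _++_; length; filter; map; deduplicate; cartesianProduct; cartesianProductWith; allFin)
open import Data.List.Properties using (length-++; length-map; length-filter; length-tabulate)
open import Data.List.Membership.Propositional using (_∈_; find; lose)
open import Data.List.Membership.Propositional.Properties
import Data.List.Membership.DecPropositional as DecMembership
open import Data.List.Relation.Binary.Sublist.Propositional as Sublist using ([]; _∷_; _∷ʳ_) renaming (_⊆_ to _⊑_)
import Data.List.Relation.Binary.Sublist.Propositional.Properties as Sublist
open import Data.List.Relation.Binary.Subset.Propositional using (_⊆_)
open import Data.List.Relation.Unary.All using (lookup) renaming (tabulate to All-tabulate)
open import Data.List.Relation.Unary.AllPairs using ([]; _∷_)
open import Data.List.Relation.Unary.Any using (Any; here; there; any?)
open import Data.List.Relation.Unary.Unique.Propositional using (Unique)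
import Data.List.Relation.Unary.Unique.DecPropositional.Properties as UniqDec
import Data.List.Relation.Unary.Unique.Propositional.Properties as Uniq
open import Data.Maybe using (Maybe; just; nothing)
open import Data.Nat.Divisibility using (_∣0; m%n≡0⇒n∣m; n∣m⇒m%n≡0) renaming (_∣_ to _divides_)
open import Data.Nat.DivMod using (_mod_; m<n⇒m%n≡m; %-distribˡ-+; %-distribˡ-*; n%n≡0; m%n%n≡m%n)
open import Data.Nat.Properties
open import Data.Nat.Tactic.RingSolver using (solve-∀)
open import Data.Product.Properties using (≡-dec)
open import Data.Sum using (_⊎_; inj₁; inj₂; [_,_]′) renaming (map to map⊎)
open import Data.Vec using ([]; _∷_; here; there)
open import Data.Vec.Properties using (lookup⇒[]=; lookup∘tabulate)
open import Function using (_∘_)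
open import Level using (0ℓ)
open import Relation.Binary.Definitions using (DecidableEquality)
open import Relation.Binary.PropositionalEquality using (_≡_; _≢_; refl; sym; trans; cong; cong₂; subst; subst₂; isEquivalence; module ≡-Reasoning)
import Relation.Binary.Reasoning.Setoid as SetoidReasoning
open import Relation.Nullary using (Dec; does; yes; no; ¬_; ¬?)
open import Relation.Nullary.Decidable using (_×-dec_; dec-true; decidable-stable)
open import Relation.Unary using (Decidable)

-- Counting in lists

-- The identity speaks only about pairs lying in a common dilate xA, so A itself need not have
-- popular differences; this is why a centre a₀ is needed. The |A|³ triples (a, p, q) are sent to
-- pairs (ap, aq), of which there are only |AA|² ≪ K⁴|A|², and a pair of small multiplicity absorbs
-- few triples; an average a₀ therefore meets few such pairs. The factor a₀ on the left of the
-- second identity is harmless, since dilation by a nonzero element preserves cardinality. Removing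
-- 0 and -1 makes dilation by a and by a + 1 injective. The pivot uses that 1 generates the additive
-- group of the field: either every element is a ratio, or some ratio r has r - 1 outside the
-- ratios. The bound |A|² < p serves the first case, where an average over all multipliers must not
-- be dominated by collisions. Estimates are kept in natural numbers, cross-multiplied: a bound |E|
-- ≤ W/X is written |E|X ≤ W. The exponent is 96 = 3·2 + 18 + 4·18: three factors |P₁|, one
-- difference set, four dilates.

private variable
  U V : Set

𝟙 : {P : Set} → Dec P → ℕ
𝟙 d = if does d then 1 else 0

∑ : List U → (U → ℕ) → ℕ
∑ []       f = 0
∑ (x ∷ xs) f = f x + ∑ xs f

count : {P : U → Set} → Decidable P → List U → ℕ
count P? xs = length (filter P? xs)

∑-mono : ∀ (xs : List U) {f g : U → ℕ} → (∀ {x} → x ∈ xs → f x ≤ g x) → ∑ xs f ≤ ∑ xs g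
∑-mono []       h = z≤n
∑-mono (x ∷ xs) h = +-mono-≤ (h (here refl)) (∑-mono xs (h ∘ there))

∑-cong : ∀ (xs : List U) {f g : U → ℕ} → (∀ x → f x ≡ g x) → ∑ xs f ≡ ∑ xs g
∑-cong []       h = refl
∑-cong (x ∷ xs) h = cong₂ _+_ (h x) (∑-cong xs h)

∑-const : ∀ (xs : List U) k → ∑ xs (λ _ → k) ≡ length xs * k
∑-const []       k = refl
∑-const (x ∷ xs) k = cong (k +_) (∑-const xs k)

∑-+ : ∀ (xs : List U) (f g : U → ℕ) → ∑ xs (λ x → f x + g x) ≡ ∑ xs f + ∑ xs g
∑-+ []       f g = refl
∑-+ (x ∷ xs) f g rewrite ∑-+ xs f g = +-interchange (f x) (g x) (∑ xs f) (∑ xs g)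
  where
  +-interchange : ∀ a b c d → (a + b) + (c + d) ≡ (a + c) + (b + d)
  +-interchange = solve-∀

∑-*ˡ : ∀ (xs : List U) k (f : U → ℕ) → ∑ xs (λ x → k * f x) ≡ k * ∑ xs f
∑-*ˡ []       k f = sym (*-zeroʳ k)
∑-*ˡ (x ∷ xs) k f = trans (cong (k * f x +_) (∑-*ˡ xs k f)) (sym (*-distribˡ-+ k (f x) (∑ xs f)))

∑-swap : ∀ (xs : List U) (ys : List V) (f : U → V → ℕ) →
  ∑ xs (λ x → ∑ ys (f x)) ≡ ∑ ys (λ y → ∑ xs (λ x → f x y))
∑-swap []       ys f = sym (trans (∑-const ys 0) (*-zeroʳ (length ys)))
∑-swap (x ∷ xs) ys f =
  trans (cong (∑ ys (f x) +_) (∑-swap xs ys f)) (sym (∑-+ ys (f x) (λ y → ∑ xs (λ x → f x y))))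

count-∑ : {P : U → Set} (P? : Decidable P) (xs : List U) → count P? xs ≡ ∑ xs (𝟙 ∘ P?)
count-∑ P? []       = refl
count-∑ P? (x ∷ xs) with does (P? x)
... | true  = cong suc (count-∑ P? xs)
... | false = count-∑ P? xs

∑-filter-split : {P : U → Set} (P? : Decidable P) (xs : List U) (f : U → ℕ) →
  ∑ (filter P? xs) f + ∑ (filter (¬? ∘ P?) xs) f ≡ ∑ xs f
∑-filter-split P? []       f = refl
∑-filter-split P? (x ∷ xs) f with does (P? x)
... | true  = trans (+-assoc (f x) _ _) (cong (f x +_) (∑-filter-split P? xs f))
... | false = trans (x+[y+z]≡y+[x+z] (∑ (filter P? xs) f) (f x) _) (cong (f x +_) (∑-filter-split P? xs f))
  where
  x+[y+z]≡y+[x+z] : ∀ a b c → a + (b + c) ≡ b + (a + c)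
  x+[y+z]≡y+[x+z] = solve-∀

∑-1 : (xs : List U) → ∑ xs (λ _ → 1) ≡ length xs
∑-1 xs = trans (∑-const xs 1) (*-identityʳ (length xs))

count-split : {P : U → Set} (P? : Decidable P) (xs : List U) →
  count P? xs + count (¬? ∘ P?) xs ≡ length xs
count-split P? xs = trans
  (cong₂ _+_ (sym (∑-1 (filter P? xs))) (sym (∑-1 (filter (¬? ∘ P?) xs))))
  (trans (∑-filter-split P? xs (λ _ → 1)) (∑-1 xs))

count-⊎ : {P Q R : U → Set} (P? : Decidable P) (Q? : Decidable Q) (R? : Decidable R) (xs : List U) →
  (∀ {x} → x ∈ xs → P x → ¬ Q x → R x) → count P? xs ≤ count Q? xs + count R? xs
count-⊎ P? Q? R? []       h = z≤n
count-⊎ P? Q? R? (x ∷ xs) h with ih ← count-⊎ P? Q? R? xs (h ∘ there) | P? x | Q? x | R? x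
... | yes p | yes q | yes r = s≤s (≤-trans ih (+-monoʳ-≤ (count Q? xs) (n≤1+n _)))
... | yes p | yes q | no ¬r = s≤s ih
... | yes p | no ¬q | yes r = ≤-trans (s≤s ih) (≤-reflexive (sym (+-suc (count Q? xs) _)))
... | yes p | no ¬q | no ¬r = ⊥-elim (¬r (h (here refl) p ¬q))
... | no ¬p | yes q | yes r = m≤n⇒m≤1+n (≤-trans ih (+-monoʳ-≤ (count Q? xs) (n≤1+n _)))
... | no ¬p | yes q | no ¬r = m≤n⇒m≤1+n ih
... | no ¬p | no ¬q | yes r = ≤-trans ih (+-monoʳ-≤ (count Q? xs) (n≤1+n _))
... | no ¬p | no ¬q | no ¬r = ih

count-positive : {P : U → Set} (P? : Decidable P) {xs : List U} {x : U} → x ∈ xs → P x → 1 ≤ count P? xs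
count-positive P? {x ∷ xs} (here refl) px with P? x
... | yes _  = s≤s z≤n
... | no ¬px = ⊥-elim (¬px px)
count-positive P? {y ∷ xs} (there x∈) px with does (P? y)
... | true  = s≤s z≤n
... | false = count-positive P? x∈ px

count-none : {P : U → Set} (P? : Decidable P) (xs : List U) → (∀ {x} → x ∈ xs → ¬ P x) → count P? xs ≡ 0
count-none P? []       h = refl
count-none P? (x ∷ xs) h with P? x
... | yes px = ⊥-elim (h (here refl) px)
... | no _   = count-none P? xs (h ∘ there)

count-≤1 : {P : U → Set} (P? : Decidable P) {xs : List U} → Unique xs →
  (∀ {x y} → x ∈ xs → y ∈ xs → P x → P y → x ≡ y) → count P? xs ≤ 1
count-≤1 P? []                          h = z≤n
count-≤1 P? {x ∷ xs} (x∉xs ∷ uniq) h with P? x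
... | yes px = s≤s (≤-reflexive (count-none P? xs (λ y∈ py → lookup x∉xs y∈ (h (here refl) (there y∈) px py))))
... | no _   = count-≤1 P? uniq (λ x∈ y∈ → h (there x∈) (there y∈))

count-double : {R : U → V → Set} (R? : ∀ x y → Dec (R x y)) (xs : List U) (ys : List V) →
  ∑ xs (λ x → count (R? x) ys) ≡ ∑ ys (λ y → count (λ x → R? x y) xs)
count-double R? xs ys = trans (∑-cong xs (λ x → count-∑ (R? x) ys))
  (trans (∑-swap xs ys (λ x y → 𝟙 (R? x y)))
         (∑-cong ys (λ y → sym (count-∑ (λ x → R? x y) xs))))

module _ {R : U → V → Set} (R? : ∀ x y → Dec (R x y)) (xs : List U) (ys : List V) where

  -- Double counting in which every x feeds at most one y. The constant `c` is a denominator: each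
  -- fibre has at least k / c elements.
  fibre-lower : ∀ c k → Unique ys → (∀ {x y y′} → y ∈ ys → y′ ∈ ys → R x y → R x y′ → y ≡ y′) →
    (∀ {y} → y ∈ ys → k ≤ c * count (λ x → R? x y) xs) → length ys * k ≤ c * length xs
  fibre-lower c k uniq functional large = begin
    length ys * k                             ≡⟨ ∑-const ys k ⟨
    ∑ ys (λ _ → k)                            ≤⟨ ∑-mono ys large ⟩
    ∑ ys (λ y → c * count (λ x → R? x y) xs)  ≡⟨ ∑-*ˡ ys c _ ⟩
    c * ∑ ys (λ y → count (λ x → R? x y) xs)  ≡⟨ cong (c *_) (count-double R? xs ys) ⟨
    c * ∑ xs (λ x → count (R? x) ys)          ≤⟨ *-monoʳ-≤ c (∑-mono xs (λ {x} _ → count-≤1 (R? x) uniq functional)) ⟩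
    c * ∑ xs (λ _ → 1)                        ≡⟨ cong (c *_) (∑-1 xs) ⟩
    c * length xs                             ∎
    where open ≤-Reasoning

  -- The dual count: every x meets some y, so the fibres, each of size at most k / c, cover `xs`.
  fibre-upper : ∀ c k → (∀ {x} → x ∈ xs → ∃ λ y → y ∈ ys × R x y) →
    (∀ {y} → y ∈ ys → c * count (λ x → R? x y) xs ≤ k) → c * length xs ≤ length ys * k
  fibre-upper c k total small = begin
    c * length xs                             ≡⟨ cong (c *_) (∑-1 xs) ⟨
    c * ∑ xs (λ _ → 1)                        ≤⟨ *-monoʳ-≤ c (∑-mono xs (λ {x} x∈ → let y , y∈ , r = total x∈ in count-positive (R? x) y∈ r)) ⟩
    c * ∑ xs (λ x → count (R? x) ys)          ≡⟨ cong (c *_) (count-double R? xs ys) ⟩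
    c * ∑ ys (λ y → count (λ x → R? x y) xs)  ≡⟨ ∑-*ˡ ys c _ ⟨
    ∑ ys (λ y → c * count (λ x → R? x y) xs)  ≤⟨ ∑-mono ys small ⟩
    ∑ ys (λ _ → k)                            ≡⟨ ∑-const ys k ⟩
    length ys * k                             ∎
    where open ≤-Reasoning

  length-≤-by : Unique xs → (∀ {x} → x ∈ xs → ∃ λ y → y ∈ ys × R x y) →
    (∀ {x x′ y} → x ∈ xs → x′ ∈ xs → R x y → R x′ y → x ≡ x′) → length xs ≤ length ys
  length-≤-by uniq total inj = subst₂ _≤_ (*-identityˡ _) (*-identityʳ _)
    (fibre-upper 1 1 total (λ {y} _ → ≤-trans (≤-reflexive (*-identityˡ _)) (count-≤1 (λ x → R? x y) uniq inj)))

module _ (_≟_ : DecidableEquality V) where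

  length-≤-inj : {xs : List U} {ys : List V} (f : U → V) → Unique xs →
    (∀ {x x′} → x ∈ xs → x′ ∈ xs → f x ≡ f x′ → x ≡ x′) → (∀ {x} → x ∈ xs → f x ∈ ys) → length xs ≤ length ys
  length-≤-inj {xs = xs} {ys} f uniq inj into = length-≤-by (λ x y → f x ≟ y) xs ys uniq
    (λ x∈ → _ , into x∈ , refl) (λ x∈ x′∈ p q → inj x∈ x′∈ (trans p (sym q)))

  length-≤-⊆ : {xs ys : List V} → Unique xs → xs ⊆ ys → length xs ≤ length ys
  length-≤-⊆ uniq xs⊆ys = length-≤-inj (λ x → x) uniq (λ _ _ p → p) xs⊆ys

-- Averaging, products and the Cauchy-Schwarz inequality

∃-below-average : ∀ (xs : List U) (f : U → ℕ) → 1 ≤ length xs →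
  ∃ λ y → y ∈ xs × length xs * f y ≤ ∑ xs f
∃-below-average (x ∷ [])         f _ = x , here refl , ≤-refl
∃-below-average (x ∷ zs@(_ ∷ _)) f _ with ∃-below-average zs f (s≤s z≤n)
... | y , y∈ , h with f x ≤? f y
...   | yes fx≤fy = x , here refl , +-monoʳ-≤ (f x) (≤-trans (*-monoʳ-≤ (length zs) fx≤fy) h)
...   | no  fx≰fy = y , there y∈ , +-mono-≤ (≰⇒≥ fx≰fy) h

∃-above-average : ∀ (xs : List U) (f : U → ℕ) → 1 ≤ length xs →
  ∃ λ y → y ∈ xs × ∑ xs f ≤ length xs * f y
∃-above-average (x ∷ [])         f _ = x , here refl , ≤-refl
∃-above-average (x ∷ zs@(_ ∷ _)) f _ with ∃-above-average zs f (s≤s z≤n)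
... | y , y∈ , h with f x ≤? f y
...   | yes fx≤fy = y , there y∈ , +-mono-≤ fx≤fy h
...   | no  fx≰fy = x , here refl , +-monoʳ-≤ (f x) (≤-trans h (*-monoʳ-≤ (length zs) (≰⇒≥ fx≰fy)))

markov : ∀ (xs : List U) (f : U → ℕ) k → count (λ x → ¬? (f x ≤? k)) xs * k ≤ ∑ xs f
markov xs f k = begin
  length large * k                              ≡⟨ ∑-const large k ⟨
  ∑ large (λ _ → k)                             ≤⟨ ∑-mono large (λ x∈ → ≰⇒≥ (proj₂ (∈-filter⁻ (λ x → ¬? (f x ≤? k)) {xs = xs} x∈))) ⟩
  ∑ large f                                     ≤⟨ m≤n+m _ _ ⟩
  ∑ (filter (λ x → f x ≤? k) xs) f + ∑ large f  ≡⟨ ∑-filter-split (λ x → f x ≤? k) xs f ⟩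
  ∑ xs f                                        ∎
  where
  open ≤-Reasoning
  large : List _
  large = filter (λ x → ¬? (f x ≤? k)) xs

∑-++ : ∀ (xs ys : List U) (f : U → ℕ) → ∑ (xs ++ ys) f ≡ ∑ xs f + ∑ ys f
∑-++ []       ys f = refl
∑-++ (x ∷ xs) ys f = trans (cong (f x +_) (∑-++ xs ys f)) (sym (+-assoc (f x) _ _))

∑-map : ∀ (g : U → V) (xs : List U) (f : V → ℕ) → ∑ (map g xs) f ≡ ∑ xs (f ∘ g)
∑-map g []       f = refl
∑-map g (x ∷ xs) f = cong (f (g x) +_) (∑-map g xs f)

∑-× : ∀ (xs : List U) (ys : List V) (f : U × V → ℕ) →
  ∑ (cartesianProduct xs ys) f ≡ ∑ xs (λ x → ∑ ys (λ y → f (x , y)))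
∑-× []       ys f = refl
∑-× (x ∷ xs) ys f = trans (∑-++ (map (x ,_) ys) (cartesianProduct xs ys) f)
  (cong₂ _+_ (∑-map (x ,_) ys f) (∑-× xs ys f))

count-× : {P : U × V → Set} (P? : Decidable P) (xs : List U) (ys : List V) →
  count P? (cartesianProduct xs ys) ≡ ∑ xs (λ x → count (λ y → P? (x , y)) ys)
count-× P? xs ys = trans (count-∑ P? (cartesianProduct xs ys))
  (trans (∑-× xs ys (𝟙 ∘ P?)) (∑-cong xs (λ x → sym (count-∑ (λ y → P? (x , y)) ys))))

length-cartesianProduct : ∀ (xs : List U) (ys : List V) →
  length (cartesianProduct xs ys) ≡ length xs * length ys
length-cartesianProduct xs ys = trans (sym (∑-1 (cartesianProduct xs ys)))
  (trans (∑-× xs ys (λ _ → 1)) (trans (∑-cong xs (λ _ → ∑-1 ys)) (∑-const xs (length ys))))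

^-distribʳ-* : ∀ o m n → (m * n) ^ o ≡ m ^ o * n ^ o
^-distribʳ-* zero    m n = refl
^-distribʳ-* (suc o) m n = trans (cong (m * n *_) (^-distribʳ-* o m n)) (*-interchange m n (m ^ o) (n ^ o))
  where
  *-interchange : ∀ a b c d → a * b * (c * d) ≡ a * c * (b * d)
  *-interchange = solve-∀

2ab≤a²+b² : ∀ a b → 2 * (a * b) ≤ a * a + b * b
2ab≤a²+b² zero    b       = z≤n
2ab≤a²+b² (suc a) zero    = ≤-trans (≤-reflexive (cong (2 *_) (*-zeroʳ (suc a)))) z≤n
2ab≤a²+b² (suc a) (suc b) = subst₂ _≤_ (lhs a b) (rhs a b) (+-monoʳ-≤ (2 + 2 * a + 2 * b) (2ab≤a²+b² a b))
  where
  lhs : ∀ a b → 2 + 2 * a + 2 * b + 2 * (a * b) ≡ 2 * (suc a * suc b)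
  lhs = solve-∀
  rhs : ∀ a b → 2 + 2 * a + 2 * b + (a * a + b * b) ≡ suc a * suc a + suc b * suc b
  rhs = solve-∀

-- Induction on the list: each cross term 2 f(x) f(z) is absorbed by f(x)² + f(z)², summed over the
-- tail.
cauchy-schwarz : ∀ (xs : List U) (f : U → ℕ) → ∑ xs f * ∑ xs f ≤ length xs * ∑ xs (λ x → f x * f x)
cauchy-schwarz []       f = z≤n
cauchy-schwarz (x ∷ xs) f = begin
  (a + S) * (a + S)                   ≡⟨ square a S ⟩
  a * a + (2 * (a * S) + S * S)       ≤⟨ +-monoʳ-≤ (a * a) (+-mono-≤ cross (cauchy-schwarz xs f)) ⟩
  a * a + (k * (a * a) + Q + k * Q)   ≡⟨ regroup a k Q ⟩
  suc k * (a * a + Q)                 ∎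
  where
  open ≤-Reasoning
  a k S Q : ℕ
  a = f x
  k = length xs
  S = ∑ xs f
  Q = ∑ xs (λ x → f x * f x)
  square : ∀ a S → (a + S) * (a + S) ≡ a * a + (2 * (a * S) + S * S)
  square = solve-∀
  regroup : ∀ a k Q → a * a + (k * (a * a) + Q + k * Q) ≡ suc k * (a * a + Q)
  regroup = solve-∀
  cross : 2 * (a * S) ≤ k * (a * a) + Q
  cross = begin
    2 * (a * S)                                ≡⟨ *-assoc 2 a S ⟨
    2 * a * S                                  ≡⟨ ∑-*ˡ xs (2 * a) f ⟨
    ∑ xs (λ z → 2 * a * f z)                   ≤⟨ ∑-mono xs (λ {z} _ → ≤-trans (≤-reflexive (*-assoc 2 a (f z))) (2ab≤a²+b² a (f z))) ⟩
    ∑ xs (λ z → a * a + f z * f z)             ≡⟨ ∑-+ xs (λ _ → a * a) (λ z → f z * f z) ⟩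
    ∑ xs (λ _ → a * a) + Q                     ≡⟨ cong (_+ Q) (∑-const xs (a * a)) ⟩
    k * (a * a) + Q                            ∎

-- Cauchy-Schwarz for the representation function `r`. The sum on the right counts collisions f(x) =
-- f(x′), so few collisions force a large image.
energy-lower : (_≟_ : DecidableEquality V) {xs : List U} {ys : List V} (f : U → V) → Unique ys →
  (∀ {x} → x ∈ xs → f x ∈ ys) →
  length xs * length xs ≤ length ys * ∑ xs (λ x → count (λ x′ → f x′ ≟ f x) xs)
energy-lower _≟_ {xs} {ys} f uniq into = begin
  length xs * length xs                 ≤⟨ *-mono-≤ total total ⟩
  ∑ ys r * ∑ ys r                       ≤⟨ cauchy-schwarz ys r ⟩
  length ys * ∑ ys (λ y → r y * r y)    ≤⟨ *-monoʳ-≤ (length ys) squares ⟩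
  length ys * ∑ xs (λ x → r (f x))      ∎
  where
  open ≤-Reasoning
  r : _ → ℕ
  r y = count (λ x → f x ≟ y) xs
  total : length xs ≤ ∑ ys r
  total = begin
    length xs                                ≡⟨ ∑-1 xs ⟨
    ∑ xs (λ _ → 1)                           ≤⟨ ∑-mono xs (λ {x} x∈ → count-positive (λ y → f x ≟ y) (into x∈) refl) ⟩
    ∑ xs (λ x → count (λ y → f x ≟ y) ys)    ≡⟨ count-double (λ x y → f x ≟ y) xs ys ⟩
    ∑ ys r                                   ∎
  -- On the support of the indicator, y may be replaced by f(x); the remaining count over `ys` is
  -- then at most 1.
  diagonal : ∀ x y → 𝟙 (f x ≟ y) * r y ≡ r (f x) * 𝟙 (f x ≟ y)
  diagonal x y with f x ≟ y
  ... | yes refl = *-comm 1 (r (f x))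
  ... | no _     = sym (*-zeroʳ (r (f x)))
  squares : ∑ ys (λ y → r y * r y) ≤ ∑ xs (λ x → r (f x))
  squares = begin
    ∑ ys (λ y → r y * r y)                                ≡⟨ ∑-cong ys (λ y → cong (r y *_) (count-∑ (λ x → f x ≟ y) xs)) ⟩
    ∑ ys (λ y → r y * ∑ xs (λ x → 𝟙 (f x ≟ y)))           ≡⟨ ∑-cong ys (λ y → sym (∑-*ˡ xs (r y) _)) ⟩
    ∑ ys (λ y → ∑ xs (λ x → r y * 𝟙 (f x ≟ y)))           ≡⟨ ∑-swap ys xs (λ y x → r y * 𝟙 (f x ≟ y)) ⟩
    ∑ xs (λ x → ∑ ys (λ y → r y * 𝟙 (f x ≟ y)))           ≡⟨ ∑-cong xs (λ x → ∑-cong ys (λ y → trans (*-comm (r y) _) (diagonal x y))) ⟩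
    ∑ xs (λ x → ∑ ys (λ y → r (f x) * 𝟙 (f x ≟ y)))       ≡⟨ ∑-cong xs (λ x → trans (∑-*ˡ ys (r (f x)) _) (cong (r (f x) *_) (sym (count-∑ (λ y → f x ≟ y) ys)))) ⟩
    ∑ xs (λ x → r (f x) * count (λ y → f x ≟ y) ys)       ≤⟨ ∑-mono xs (λ {x} _ → ≤-trans (*-monoʳ-≤ (r (f x)) (count-≤1 (λ y → f x ≟ y) uniq (λ _ _ p q → trans (sym p) q))) (≤-reflexive (*-identityʳ (r (f x))))) ⟩
    ∑ xs (λ x → r (f x))                                  ∎

-- Numerical bookkeeping

-- Stated for a variable t (to be instantiated with 2), so that no large numeral is ever unfolded.
pivot-numbers : ∀ t n u m z D H X W → m * m * m ≤ t ^ 2 * (D * H) → D * X ≤ W → H * (z ^ 3 * X ^ 4) ≤ t ^ 4 * (t ^ 2 * W) ^ 4 →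
  n * n * n ≤ t ^ 2 * u * m → n ≤ t * z → (n * n * n) ^ 3 * n ^ 3 * X ^ 5 ≤ t ^ 23 * (u ^ 3 * W ^ 5)
pivot-numbers t n u m z D H X W h₁ h₂ h₃ h₄ h₅ = begin
  (n * n * n) ^ 3 * n ^ 3 * X ^ 5                            ≤⟨ *-monoˡ-≤ (X ^ 5) (*-mono-≤ (^-monoˡ-≤ 3 h₄) (^-monoˡ-≤ 3 h₅)) ⟩
  (t ^ 2 * u * m) ^ 3 * (t * z) ^ 3 * X ^ 5                  ≡⟨ e₁ (t ^ 2) t u m z X ⟩
  (t ^ 2) ^ 3 * t ^ 3 * u ^ 3 * (z ^ 3 * X ^ 4 * X) * (m * m * m) ≤⟨ *-monoʳ-≤ ((t ^ 2) ^ 3 * t ^ 3 * u ^ 3 * (z ^ 3 * X ^ 4 * X)) h₁ ⟩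
  (t ^ 2) ^ 3 * t ^ 3 * u ^ 3 * (z ^ 3 * X ^ 4 * X) * (t ^ 2 * (D * H)) ≡⟨ e₂ ((t ^ 2) ^ 3 * t ^ 3) (t ^ 2) (u ^ 3) (z ^ 3 * X ^ 4) X D H ⟩
  (t ^ 2) ^ 3 * t ^ 3 * t ^ 2 * u ^ 3 * ((D * X) * (H * (z ^ 3 * X ^ 4))) ≤⟨ *-monoʳ-≤ ((t ^ 2) ^ 3 * t ^ 3 * t ^ 2 * u ^ 3) (*-mono-≤ h₂ h₃) ⟩
  (t ^ 2) ^ 3 * t ^ 3 * t ^ 2 * u ^ 3 * (W * (t ^ 4 * (t ^ 2 * W) ^ 4)) ≡⟨ e₃ t (u ^ 3) W ⟩
  t ^ 23 * (u ^ 3 * W ^ 5)                                   ∎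
  where
  open ≤-Reasoning
  e₁ : ∀ f t u m z X → (f * u * m) * ((f * u * m) * ((f * u * m) * 1)) * ((t * z) * ((t * z) * ((t * z) * 1))) * (X * (X * (X * (X * (X * 1)))))
    ≡ (f * (f * (f * 1))) * (t * (t * (t * 1))) * (u * (u * (u * 1))) * ((z * (z * (z * 1))) * (X * (X * (X * (X * 1)))) * X) * (m * m * m)
  e₁ = solve-∀
  e₂ : ∀ c f u t X D H → c * u * (t * X) * (f * (D * H)) ≡ c * f * u * ((D * X) * (H * t))
  e₂ = solve-∀
  r : ∀ a b c u W d W′ → a * b * c * u * (W * (d * W′)) ≡ a * b * c * d * (u * (W * W′))
  r = solve-∀
  r′ : ∀ a b c d e u W W′ → a * b * c * d * (u * (W * (e * W′))) ≡ a * b * c * d * e * (u * (W * W′))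
  r′ = solve-∀
  e₃ : ∀ t u W → (t ^ 2) ^ 3 * t ^ 3 * t ^ 2 * u * (W * (t ^ 4 * (t ^ 2 * W) ^ 4)) ≡ t ^ 23 * (u * W ^ 5)
  e₃ t u W = begin-equality
    (t ^ 2) ^ 3 * t ^ 3 * t ^ 2 * u * (W * (t ^ 4 * (t ^ 2 * W) ^ 4))         ≡⟨ r ((t ^ 2) ^ 3) (t ^ 3) (t ^ 2) u W (t ^ 4) ((t ^ 2 * W) ^ 4) ⟩
    (t ^ 2) ^ 3 * t ^ 3 * t ^ 2 * t ^ 4 * (u * (W * (t ^ 2 * W) ^ 4))         ≡⟨ cong (λ v → (t ^ 2) ^ 3 * t ^ 3 * t ^ 2 * t ^ 4 * (u * (W * v))) (^-distribʳ-* 4 (t ^ 2) W) ⟩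
    (t ^ 2) ^ 3 * t ^ 3 * t ^ 2 * t ^ 4 * (u * (W * ((t ^ 2) ^ 4 * W ^ 4)))     ≡⟨ r′ ((t ^ 2) ^ 3) (t ^ 3) (t ^ 2) (t ^ 4) ((t ^ 2) ^ 4) u W (W ^ 4) ⟩
    (t ^ 2) ^ 3 * t ^ 3 * t ^ 2 * t ^ 4 * (t ^ 2) ^ 4 * (u * W ^ 5)             ≡⟨ cong (_* (u * W ^ 5)) powers ⟩
    t ^ 23 * (u * W ^ 5)                                                    ∎
    where
    powers : (t ^ 2) ^ 3 * t ^ 3 * t ^ 2 * t ^ 4 * (t ^ 2) ^ 4 ≡ t ^ 23
    powers = begin-equality
      (t ^ 2) ^ 3 * t ^ 3 * t ^ 2 * t ^ 4 * (t ^ 2) ^ 4   ≡⟨ cong₂ (λ a b → a * t ^ 3 * t ^ 2 * t ^ 4 * b) (^-*-assoc t 2 3) (^-*-assoc t 2 4) ⟩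
      t ^ 6 * t ^ 3 * t ^ 2 * t ^ 4 * t ^ 8           ≡⟨ cong (λ a → a * t ^ 2 * t ^ 4 * t ^ 8) (^-distribˡ-+-* t 6 3) ⟨
      t ^ 9 * t ^ 2 * t ^ 4 * t ^ 8                   ≡⟨ cong (λ a → a * t ^ 4 * t ^ 8) (^-distribˡ-+-* t 9 2) ⟨
      t ^ 11 * t ^ 4 * t ^ 8                          ≡⟨ cong (_* t ^ 8) (^-distribˡ-+-* t 11 4) ⟨
      t ^ 15 * t ^ 8                                  ≡⟨ ^-distribˡ-+-* t 15 8 ⟨
      t ^ 23                                          ∎

-- On the left 9 + 3 + 5·17 = 97. On the right u³u³⁵ = (4s²)³⁸, so s receives 76 + 20 = 96 and 2
-- receives 23 + 55 + 76 = 154; again `t` stands for 2.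
collect-powers : ∀ t n s u X W → u ≡ t ^ 2 * s ^ 2 → X ≡ t * n ^ 17 → W ≡ t ^ 11 * (u ^ 7 * s ^ 4) → 1 ≤ t →
  (n * n * n) ^ 3 * n ^ 3 * X ^ 5 ≤ t ^ 23 * (u ^ 3 * W ^ 5) → n ^ 97 ≤ t ^ 154 * s ^ 96
collect-powers t n s u X W refl refl refl t>0 h = begin
  n ^ 97                              ≤⟨ m≤n*m (n ^ 97) (t ^ 5) ⦃ m^n≢0 t 5 ⦃ >-nonZero t>0 ⦄ ⦄ ⟩
  t ^ 5 * n ^ 97                      ≡⟨ left ⟨
  (n * n * n) ^ 3 * n ^ 3 * X ^ 5     ≤⟨ h ⟩
  t ^ 23 * (u ^ 3 * W ^ 5)            ≡⟨ right ⟩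
  t ^ 154 * s ^ 96                    ∎
  where
  open ≤-Reasoning
  cube : ∀ n → n * n * n ≡ n * (n * (n * 1))
  cube = solve-∀
  r₁ : ∀ a b c d → a * b * (c * d) ≡ c * (a * b * d)
  r₁ = solve-∀
  r₂ : ∀ a b c d e → a * (b * (c * (d * e))) ≡ (a * c) * ((b * d) * e)
  r₂ = solve-∀
  r₃ : ∀ a b c d → a * ((b * c) * d) ≡ (a * b) * (c * d)
  r₃ = solve-∀
  left : (n * n * n) ^ 3 * n ^ 3 * X ^ 5 ≡ t ^ 5 * n ^ 97
  left = begin-equality
    (n * n * n) ^ 3 * n ^ 3 * X ^ 5                 ≡⟨ cong₂ (λ a b → a * n ^ 3 * b) (trans (cong (_^ 3) (cube n)) (^-*-assoc n 3 3)) (^-distribʳ-* 5 t (n ^ 17)) ⟩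
    n ^ 9 * n ^ 3 * (t ^ 5 * (n ^ 17) ^ 5)          ≡⟨ r₁ (n ^ 9) (n ^ 3) (t ^ 5) ((n ^ 17) ^ 5) ⟩
    t ^ 5 * (n ^ 9 * n ^ 3 * (n ^ 17) ^ 5)          ≡⟨ cong (t ^ 5 *_) (cong₂ _*_ (sym (^-distribˡ-+-* n 9 3)) (^-*-assoc n 17 5)) ⟩
    t ^ 5 * (n ^ 12 * n ^ 85)                       ≡⟨ cong (t ^ 5 *_) (sym (^-distribˡ-+-* n 12 85)) ⟩
    t ^ 5 * n ^ 97                                  ∎
  right : t ^ 23 * (u ^ 3 * W ^ 5) ≡ t ^ 154 * s ^ 96
  right = begin-equality
    t ^ 23 * (u ^ 3 * (t ^ 11 * (u ^ 7 * s ^ 4)) ^ 5)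
      ≡⟨ cong (λ a → t ^ 23 * (u ^ 3 * a)) (trans (^-distribʳ-* 5 (t ^ 11) (u ^ 7 * s ^ 4)) (cong₂ _*_ (^-*-assoc t 11 5)
           (trans (^-distribʳ-* 5 (u ^ 7) (s ^ 4)) (cong₂ _*_ (^-*-assoc u 7 5) (^-*-assoc s 4 5))))) ⟩
    t ^ 23 * (u ^ 3 * (t ^ 55 * (u ^ 35 * s ^ 20)))
      ≡⟨ r₂ (t ^ 23) (u ^ 3) (t ^ 55) (u ^ 35) (s ^ 20) ⟩
    t ^ 23 * t ^ 55 * (u ^ 3 * u ^ 35 * s ^ 20)
      ≡⟨ cong₂ (λ a b → a * (b * s ^ 20)) (sym (^-distribˡ-+-* t 23 55)) (sym (^-distribˡ-+-* u 3 35)) ⟩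
    t ^ 78 * (u ^ 38 * s ^ 20)
      ≡⟨ cong (λ a → t ^ 78 * (a * s ^ 20)) (trans (^-distribʳ-* 38 (t ^ 2) (s ^ 2)) (cong₂ _*_ (^-*-assoc t 2 38) (^-*-assoc s 2 38))) ⟩
    t ^ 78 * (t ^ 76 * s ^ 76 * s ^ 20)
      ≡⟨ r₃ (t ^ 78) (t ^ 76) (s ^ 76) (s ^ 20) ⟩
    t ^ 78 * t ^ 76 * (s ^ 76 * s ^ 20)
      ≡⟨ cong₂ _*_ (sym (^-distribˡ-+-* t 78 76)) (sym (^-distribˡ-+-* s 76 20)) ⟩
    t ^ 154 * s ^ 96 ∎

-- If s^y < N^x, the y-th power of the last hypothesis leaves N^r ≤ C^y, whereas y < l r and C^l ≤ N
-- give C^y < N^r. The surplus r, by which p / q exceeds x / y, swallows the constant.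
exponent-comparison : ∀ p q x y r l C N s → p * y ≡ x * q + r → suc y ≤ l * r → 2 ≤ C → C ^ l ≤ N →
  N ^ p ≤ C * s ^ q → N ^ x ≤ s ^ y
exponent-comparison p q x y r l C N s eq y<lr C>1 C^l≤N h = ≮⇒≥ λ s^y<N^x → <-irrefl refl (begin-strict
  N ^ r            ≤⟨ *-cancelˡ-≤ (N ^ (x * q)) ⦃ m^n≢0 N (x * q) ⦃ N≢0 ⦄ ⦄ (begin
    N ^ (x * q) * N ^ r        ≡⟨ ^-distribˡ-+-* N (x * q) r ⟨
    N ^ (x * q + r)            ≡⟨ cong (N ^_) eq ⟨
    N ^ (p * y)                ≡⟨ ^-*-assoc N p y ⟨
    (N ^ p) ^ y                ≤⟨ ^-monoˡ-≤ y h ⟩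
    (C * s ^ q) ^ y            ≡⟨ ^-distribʳ-* y C (s ^ q) ⟩
    C ^ y * (s ^ q) ^ y        ≡⟨ cong (C ^ y *_) (trans (^-*-assoc s q y) (trans (cong (s ^_) (*-comm q y)) (sym (^-*-assoc s y q)))) ⟩
    C ^ y * (s ^ y) ^ q        ≤⟨ *-monoʳ-≤ (C ^ y) (^-monoˡ-≤ q (<⇒≤ s^y<N^x)) ⟩
    C ^ y * (N ^ x) ^ q        ≡⟨ trans (*-comm (C ^ y) _) (cong (_* C ^ y) (^-*-assoc N x q)) ⟩
    N ^ (x * q) * C ^ y        ∎) ⟩
  C ^ y            <⟨ ^-monoʳ-< C C>1 y<lr ⟩
  C ^ (l * r)      ≡⟨ ^-*-assoc C l r ⟨
  (C ^ l) ^ r      ≤⟨ ^-monoˡ-≤ r C^l≤N ⟩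
  N ^ r            ∎)
  where
  open ≤-Reasoning
  N≢0 : NonZero N
  N≢0 = >-nonZero (≤-trans (m^n>0 C ⦃ >-nonZero (≤-trans (s≤s z≤n) C>1) ⦄ l) C^l≤N)

-- Sumsets and Plünnecke's inequality

nonempty : {xs : List U} → 1 ≤ length xs → ∃ λ x → x ∈ xs
nonempty {xs = x ∷ _} _ = x , here refl

sublists : List U → List (List U)
sublists []       = [] ∷ []
sublists (x ∷ xs) = sublists xs ++ map (x ∷_) (sublists xs)

∈-sublists⁺ : {xs ys : List U} → xs ⊑ ys → xs ∈ sublists ys
∈-sublists⁺ []            = here refl
∈-sublists⁺ (y ∷ʳ s)      = ∈-++⁺ˡ (∈-sublists⁺ s)
∈-sublists⁺ {ys = y ∷ ys} (refl ∷ s) = ∈-++⁺ʳ (sublists ys) (∈-map⁺ (y ∷_) (∈-sublists⁺ s))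

∈-sublists⁻ : {xs : List U} (ys : List U) → xs ∈ sublists ys → xs ⊑ ys
∈-sublists⁻ []       (here refl) = []
∈-sublists⁻ (y ∷ ys) xs∈ with ∈-++⁻ (sublists ys) xs∈
... | inj₁ p = y ∷ʳ ∈-sublists⁻ ys p
... | inj₂ p with ∈-map⁻ (y ∷_) p
...   | _ , q , refl = refl ∷ ∈-sublists⁻ ys q

ratio-trans : ∀ f₁ g₁ f₂ g₂ f₃ g₃ → 1 ≤ g₂ → f₁ * g₂ ≤ f₂ * g₁ → f₂ * g₃ ≤ f₃ * g₂ → f₁ * g₃ ≤ f₃ * g₁
ratio-trans f₁ g₁ f₂ g₂ f₃ g₃ g₂>0 p q = *-cancelʳ-≤ _ _ g₂ ⦃ >-nonZero g₂>0 ⦄ (begin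
  f₁ * g₃ * g₂    ≡⟨ swapʳ f₁ g₃ g₂ ⟩
  f₁ * g₂ * g₃    ≤⟨ *-monoˡ-≤ g₃ p ⟩
  f₂ * g₁ * g₃    ≡⟨ swapʳ f₂ g₁ g₃ ⟩
  f₂ * g₃ * g₁    ≤⟨ *-monoˡ-≤ g₁ q ⟩
  f₃ * g₂ * g₁    ≡⟨ swapʳ f₃ g₂ g₁ ⟩
  f₃ * g₁ * g₂    ∎)
  where
  open ≤-Reasoning
  swapʳ : ∀ a b c → a * b * c ≡ a * c * b
  swapʳ = solve-∀

-- Ratios f / g are compared by cross multiplication. An entry with g = 0 never displaces the
-- current minimiser, because a strict failure of the comparison forces g > 0; so the empty set
-- cannot win below.
argmin-ratio : (f g : U → ℕ) {P : U → Set} {x : U} (zs : List U) → 1 ≤ g x → P x → (∀ {z} → z ∈ zs → P z) →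
  ∃ λ m → P m × 1 ≤ g m × f m * g x ≤ f x * g m × (∀ {z} → z ∈ zs → f m * g z ≤ f z * g m)
argmin-ratio f g {x = x} [] gx>0 px pzs = x , px , gx>0 , ≤-refl , λ ()
argmin-ratio f g {P} {x} (y ∷ zs) gx>0 px pzs
  with argmin-ratio f g {P} {x} zs gx>0 px (pzs ∘ there)
... | m , pm , gm>0 , m≤x , m≤zs with f m * g y ≤? f y * g m
...   | yes m≤y = m , pm , gm>0 , m≤x , λ { (here refl) → m≤y ; (there z∈) → m≤zs z∈ }
...   | no  m≰y = y , pzs (here refl) , gy>0 , y≤ m≤x ,
                  λ { (here refl) → ≤-refl ; (there z∈) → y≤ (m≤zs z∈) }
  where
  gy>0 : 1 ≤ g y
  gy>0 = n≢0⇒n>0 (λ eq → m≰y (≤-trans (≤-reflexive (trans (cong (f m *_) eq) (*-zeroʳ (f m)))) z≤n))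
  y≤ : ∀ {z} → f m * g z ≤ f z * g m → f y * g z ≤ f z * g y
  y≤ {z} = ratio-trans (f y) (g y) (f m) (g m) (f z) (g z) gm>0 (≰⇒≥ m≰y)

unique-⊑ : {xs ys : List U} → xs ⊑ ys → Unique ys → Unique xs
unique-⊑ []         []        = []
unique-⊑ (_ ∷ʳ s)   (_ ∷ u)   = unique-⊑ s u
unique-⊑ (refl ∷ s) (y∉ ∷ u) = Sublist.All-resp-⊆ s y∉ ∷ unique-⊑ s u

module Image {G : Set} (_≟_ : DecidableEquality G) where

  abstract

    -- Opaque: afterwards only the two membership rules and uniqueness are used.
    image₂ : (U → V → G) → List U → List V → List G
    image₂ f xs ys = deduplicate _≟_ (cartesianProductWith f xs ys)

    ∈-image₂⁺ : (f : U → V → G) {xs : List U} {ys : List V} {x : U} {y : V} →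
      x ∈ xs → y ∈ ys → f x y ∈ image₂ f xs ys
    ∈-image₂⁺ f x∈ y∈ = ∈-deduplicate⁺ _≟_ (∈-cartesianProductWith⁺ f x∈ y∈)

    ∈-image₂⁻ : (f : U → V → G) (xs : List U) (ys : List V) {z : G} →
      z ∈ image₂ f xs ys → ∃₂ λ x y → x ∈ xs × y ∈ ys × z ≡ f x y
    ∈-image₂⁻ f xs ys z∈ =
      ∈-cartesianProductWith⁻ f xs ys (∈-deduplicate⁻ _≟_ (cartesianProductWith f xs ys) z∈)

    image₂-unique : (f : U → V → G) (xs : List U) (ys : List V) → Unique (image₂ f xs ys)
    image₂-unique f xs ys = UniqDec.deduplicate-! _≟_ (cartesianProductWith f xs ys)

-- Petridis' proof of Plünnecke's inequality, run with the weighted functional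
-- w₁|EB| + w₂|EC| so that two different summands can be treated at once.
module Plünnecke {G : Set} (_≟_ : DecidableEquality G) (_∙_ : G → G → G)
  (∙-assoc : ∀ x y z → (x ∙ y) ∙ z ≡ x ∙ (y ∙ z)) (∙-comm : ∀ x y → x ∙ y ≡ y ∙ x) where

  open Image _≟_
  open DecMembership _≟_ using (_∈?_)

  infixl 7 _⊙_
  _⊙_ : List G → List G → List G
  _⊙_ = image₂ _∙_

  ⟦_⟧ : List G → ℕ
  ⟦_⟧ = length

  -- Asked of individual elements, so that the same argument serves multiplication in a domain,
  -- where 0 may fail it.
  Cancellable : G → Set
  Cancellable d = ∀ {x y} → x ∙ d ≡ y ∙ d → x ≡ y

  module Step (Q D : List G) (uniqQ : Unique Q) {d : G} (cancel : Cancellable d) where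

    Q″ : List G
    Q″ = filter (λ q → (q ∙ d) ∈? (Q ⊙ D)) Q

    -- Sort `Q ⊙ B` by whether multiplication by `d` lands in `Q ⊙ D ⊙ B`. The part that does
    -- contains `Q″ ⊙ B`; only the rest produces new elements when `d` joins `D`.
    submodular : ∀ B → ⟦ Q ⊙ (d ∷ D) ⊙ B ⟧ + ⟦ Q″ ⊙ B ⟧ ≤ ⟦ Q ⊙ D ⊙ B ⟧ + ⟦ Q ⊙ B ⟧
    submodular B = begin
      ⟦ Q ⊙ (d ∷ D) ⊙ B ⟧ + ⟦ Q″ ⊙ B ⟧                       ≤⟨ +-mono-≤ new shared ⟩
      (⟦ Q ⊙ D ⊙ B ⟧ + length miss) + length hit     ≡⟨ +-assoc ⟦ Q ⊙ D ⊙ B ⟧ (length miss) (length hit) ⟩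
      ⟦ Q ⊙ D ⊙ B ⟧ + (length miss + length hit)     ≡⟨ cong (⟦ Q ⊙ D ⊙ B ⟧ +_) (trans (+-comm (length miss) _) (count-split hit? (Q ⊙ B))) ⟩
      ⟦ Q ⊙ D ⊙ B ⟧ + ⟦ Q ⊙ B ⟧                             ∎
      where
      open ≤-Reasoning
      hit? : ∀ z → Dec ((z ∙ d) ∈ (Q ⊙ D ⊙ B))
      hit? z = (z ∙ d) ∈? (Q ⊙ D ⊙ B)
      hit miss : List G
      hit = filter hit? (Q ⊙ B)
      miss = filter (¬? ∘ hit?) (Q ⊙ B)
      rotate : ∀ x y z → (x ∙ y) ∙ z ≡ (x ∙ z) ∙ y
      rotate x y z = trans (∙-assoc x y z) (trans (cong (x ∙_) (∙-comm y z)) (sym (∙-assoc x z y)))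
      shared : ⟦ Q″ ⊙ B ⟧ ≤ length hit
      shared = length-≤-⊆ _≟_ (image₂-unique _∙_ Q″ B) λ z∈ →
        let q , b , q∈ , b∈ , eq = ∈-image₂⁻ _∙_ Q″ B z∈
            q∈Q , qd∈ = ∈-filter⁻ (λ q → (q ∙ d) ∈? (Q ⊙ D)) {xs = Q} q∈
        in subst (_∈ hit) (sym eq) (∈-filter⁺ hit? (∈-image₂⁺ _∙_ q∈Q b∈)
             (subst (_∈ (Q ⊙ D ⊙ B)) (rotate q d b) (∈-image₂⁺ _∙_ qd∈ b∈)))
      new : ⟦ Q ⊙ (d ∷ D) ⊙ B ⟧ ≤ ⟦ Q ⊙ D ⊙ B ⟧ + length miss
      new = ≤-trans (length-≤-⊆ _≟_ {ys = Q ⊙ D ⊙ B ++ map (_∙ d) miss} (image₂-unique _∙_ (Q ⊙ (d ∷ D)) B) covered)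
              (≤-reflexive (trans (length-++ (Q ⊙ D ⊙ B)) (cong (⟦ Q ⊙ D ⊙ B ⟧ +_) (length-map (_∙ d) miss))))
        where
        covered : Q ⊙ (d ∷ D) ⊙ B ⊆ Q ⊙ D ⊙ B ++ map (_∙ d) miss
        covered z∈ with ∈-image₂⁻ _∙_ (Q ⊙ (d ∷ D)) B z∈
        ... | e , b , e∈ , b∈ , refl with ∈-image₂⁻ _∙_ Q (d ∷ D) e∈
        ...   | q , d′ , q∈ , there d′∈ , refl = ∈-++⁺ˡ (∈-image₂⁺ _∙_ (∈-image₂⁺ _∙_ q∈ d′∈) b∈)
        ...   | q , .d , q∈ , here refl , refl with hit? (q ∙ b)
        ...     | yes i = ∈-++⁺ˡ (subst (_∈ (Q ⊙ D ⊙ B)) (rotate q b d) i)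
        ...     | no ¬i = ∈-++⁺ʳ (Q ⊙ D ⊙ B) (subst (_∈ map (_∙ d) miss) (rotate q b d)
                            (∈-map⁺ (_∙ d) (∈-filter⁺ (¬? ∘ hit?) (∈-image₂⁺ _∙_ q∈ b∈) ¬i)))

    -- The products `q ∙ d` with q outside `Q″` are distinct by cancellation and lie outside
    -- `Q ⊙ D`.
    growth : ⟦ Q ⊙ D ⟧ + ⟦ Q ⟧ ≤ ⟦ Q ⊙ (d ∷ D) ⟧ + ⟦ Q″ ⟧
    growth = begin
      ⟦ Q ⊙ D ⟧ + ⟦ Q ⟧                        ≡⟨ cong (⟦ Q ⊙ D ⟧ +_) (trans (+-comm (length fresh) ⟦ Q″ ⟧) (count-split old? Q)) ⟨
      ⟦ Q ⊙ D ⟧ + (length fresh + ⟦ Q″ ⟧)       ≡⟨ +-assoc ⟦ Q ⊙ D ⟧ (length fresh) ⟦ Q″ ⟧ ⟨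
      (⟦ Q ⊙ D ⟧ + length fresh) + ⟦ Q″ ⟧       ≤⟨ +-monoˡ-≤ ⟦ Q″ ⟧ enlarge ⟩
      ⟦ Q ⊙ (d ∷ D) ⟧ + ⟦ Q″ ⟧                  ∎
      where
      open ≤-Reasoning
      old? : ∀ q → Dec ((q ∙ d) ∈ (Q ⊙ D))
      old? q = (q ∙ d) ∈? (Q ⊙ D)
      fresh : List G
      fresh = filter (¬? ∘ old?) Q
      disjoint : ∀ {z} → ¬ (z ∈ (Q ⊙ D) × z ∈ map (_∙ d) fresh)
      disjoint (z∈ , z∈′) with ∈-map⁻ (_∙ d) z∈′
      ... | q , q∈ , refl = proj₂ (∈-filter⁻ (¬? ∘ old?) {xs = Q} q∈) z∈
      included : Q ⊙ D ++ map (_∙ d) fresh ⊆ Q ⊙ (d ∷ D)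
      included z∈ with ∈-++⁻ (Q ⊙ D) z∈
      ... | inj₁ p with ∈-image₂⁻ _∙_ Q D p
      ...   | q , d′ , q∈ , d′∈ , refl = ∈-image₂⁺ _∙_ q∈ (there d′∈)
      included z∈ | inj₂ p with ∈-map⁻ (_∙ d) p
      ...   | q , q∈ , refl = ∈-image₂⁺ _∙_ (proj₁ (∈-filter⁻ (¬? ∘ old?) {xs = Q} q∈)) (here refl)
      enlarge : ⟦ Q ⊙ D ⟧ + length fresh ≤ ⟦ Q ⊙ (d ∷ D) ⟧
      enlarge = ≤-trans
        (≤-reflexive (sym (trans (length-++ (Q ⊙ D)) (cong (⟦ Q ⊙ D ⟧ +_) (length-map (_∙ d) fresh)))))
        (length-≤-⊆ _≟_ (Uniq.++⁺ (image₂-unique _∙_ Q D) (Uniq.map⁺ cancel (Uniq.filter⁺ (¬? ∘ old?) uniqQ)) disjoint) included)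

  image-positive : (xs ys : List G) → 1 ≤ ⟦ xs ⟧ → 1 ≤ ⟦ ys ⟧ → 1 ≤ ⟦ xs ⊙ ys ⟧
  image-positive xs ys xs>0 ys>0 =
    ∈-length (∈-image₂⁺ _∙_ (proj₂ (nonempty {xs = xs} xs>0)) (proj₂ (nonempty {xs = ys} ys>0)))

  module _ (B C : List G) (w₁ w₂ : ℕ) where

    weight : List G → ℕ
    weight E = w₁ * ⟦ E ⊙ B ⟧ + w₂ * ⟦ E ⊙ C ⟧

    -- Induction on `D`. Adding d raises the weight by at most weight(Q) - weight(Q″) and the size
    -- by at least |Q| - |Q″|; minimality of `Q`, tested at its subset `Q″`, compares the two
    -- amounts.
    petridis : ∀ {Q} → Unique Q → (∀ {Q′} → Q′ ⊑ Q → weight Q * ⟦ Q′ ⟧ ≤ weight Q′ * ⟦ Q ⟧) →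
      ∀ D → (∀ {d} → d ∈ D → Cancellable d) → weight (Q ⊙ D) * ⟦ Q ⟧ ≤ weight Q * ⟦ Q ⊙ D ⟧
    petridis {Q} uniqQ minimal []      cancel = ≤-trans (≤-reflexive (cong (_* ⟦ Q ⟧) vanish)) z≤n
      where
      empty : ∀ E → ⟦ Q ⊙ [] ⊙ E ⟧ ≡ 0
      empty E with Q ⊙ [] ⊙ E in eq
      ... | []    = refl
      ... | z ∷ _ with ∈-image₂⁻ _∙_ (Q ⊙ []) E (subst (z ∈_) (sym eq) (here refl))
      ...   | _ , _ , p , _ with ∈-image₂⁻ _∙_ Q [] p
      ...     | _ , _ , _ , () , _
      vanish : weight (Q ⊙ []) ≡ 0
      vanish = cong₂ _+_ (trans (cong (w₁ *_) (empty B)) (*-zeroʳ w₁)) (trans (cong (w₂ *_) (empty C)) (*-zeroʳ w₂))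
    petridis {Q} uniqQ minimal (d ∷ D) cancel = +-cancelʳ-≤ (weight Q″ * ⟦ Q ⟧) _ _ (begin
      weight (Q ⊙ (d ∷ D)) * ⟦ Q ⟧ + weight Q″ * ⟦ Q ⟧   ≡⟨ *-distribʳ-+ ⟦ Q ⟧ (weight (Q ⊙ (d ∷ D))) (weight Q″) ⟨
      (weight (Q ⊙ (d ∷ D)) + weight Q″) * ⟦ Q ⟧         ≤⟨ *-monoˡ-≤ ⟦ Q ⟧ weight-submodular ⟩
      (weight (Q ⊙ D) + weight Q) * ⟦ Q ⟧                ≡⟨ *-distribʳ-+ ⟦ Q ⟧ (weight (Q ⊙ D)) (weight Q) ⟩
      weight (Q ⊙ D) * ⟦ Q ⟧ + weight Q * ⟦ Q ⟧          ≤⟨ +-monoˡ-≤ (weight Q * ⟦ Q ⟧) (petridis uniqQ minimal D (cancel ∘ there)) ⟩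
      weight Q * ⟦ Q ⊙ D ⟧ + weight Q * ⟦ Q ⟧            ≡⟨ *-distribˡ-+ (weight Q) ⟦ Q ⊙ D ⟧ ⟦ Q ⟧ ⟨
      weight Q * (⟦ Q ⊙ D ⟧ + ⟦ Q ⟧)                     ≤⟨ *-monoʳ-≤ (weight Q) growth ⟩
      weight Q * (⟦ Q ⊙ (d ∷ D) ⟧ + ⟦ Q″ ⟧)              ≡⟨ *-distribˡ-+ (weight Q) ⟦ Q ⊙ (d ∷ D) ⟧ ⟦ Q″ ⟧ ⟩
      weight Q * ⟦ Q ⊙ (d ∷ D) ⟧ + weight Q * ⟦ Q″ ⟧     ≤⟨ +-monoʳ-≤ (weight Q * ⟦ Q ⊙ (d ∷ D) ⟧) (minimal (Sublist.filter-⊆ _ Q)) ⟩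
      weight Q * ⟦ Q ⊙ (d ∷ D) ⟧ + weight Q″ * ⟦ Q ⟧     ∎)
      where
      open ≤-Reasoning
      open Step Q D uniqQ (cancel (here refl))
      distribute : ∀ w₁ w₂ a b c d → w₁ * (a + b) + w₂ * (c + d) ≡ (w₁ * a + w₂ * c) + (w₁ * b + w₂ * d)
      distribute = solve-∀
      weight-submodular : weight (Q ⊙ (d ∷ D)) + weight Q″ ≤ weight (Q ⊙ D) + weight Q
      weight-submodular = begin
        weight (Q ⊙ (d ∷ D)) + weight Q″
          ≡⟨ distribute w₁ w₂ ⟦ Q ⊙ (d ∷ D) ⊙ B ⟧ ⟦ Q″ ⊙ B ⟧ ⟦ Q ⊙ (d ∷ D) ⊙ C ⟧ ⟦ Q″ ⊙ C ⟧ ⟨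
        w₁ * (⟦ Q ⊙ (d ∷ D) ⊙ B ⟧ + ⟦ Q″ ⊙ B ⟧) + w₂ * (⟦ Q ⊙ (d ∷ D) ⊙ C ⟧ + ⟦ Q″ ⊙ C ⟧)
          ≤⟨ +-mono-≤ (*-monoʳ-≤ w₁ (submodular B)) (*-monoʳ-≤ w₂ (submodular C)) ⟩
        w₁ * (⟦ Q ⊙ D ⊙ B ⟧ + ⟦ Q ⊙ B ⟧) + w₂ * (⟦ Q ⊙ D ⊙ C ⟧ + ⟦ Q ⊙ C ⟧)
          ≡⟨ distribute w₁ w₂ ⟦ Q ⊙ D ⊙ B ⟧ ⟦ Q ⊙ B ⟧ ⟦ Q ⊙ D ⊙ C ⟧ ⟦ Q ⊙ C ⟧ ⟩
        weight (Q ⊙ D) + weight Q ∎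

  -- With w₁ = |ZC| and w₂ = |ZB| the two terms of the weight of `Z` are equal, so it is 2|ZB||ZC|.
  -- For a minimising `Q` and D = C, the first term of weight(QC) controls |QCB| and the second term
  -- of weight(Q) controls |QC|. The factor 2 enters twice, hence the 4.
  plünnecke : ∀ {Z B C} → Unique Z → 1 ≤ ⟦ Z ⟧ → 1 ≤ ⟦ B ⟧ → 1 ≤ ⟦ C ⟧ → (∀ {c} → c ∈ C → Cancellable c) →
    ∃ λ Q → Q ⊆ Z × Unique Q × 1 ≤ ⟦ Q ⟧ ×
      ⟦ Q ⊙ C ⊙ B ⟧ * (⟦ Z ⟧ * ⟦ Z ⟧) ≤ 4 * (⟦ Z ⊙ B ⟧ * ⟦ Z ⊙ C ⟧) * ⟦ Q ⟧
  plünnecke {Z} {B} {C} uniqZ Z>0 B>0 C>0 cancel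
    with argmin-ratio (weight B C ⟦ Z ⊙ C ⟧ ⟦ Z ⊙ B ⟧) length {_⊑ Z} (sublists Z) Z>0 Sublist.⊆-refl (∈-sublists⁻ Z)
  ... | Q , Q⊑Z , Q>0 , Q≤Z , Q≤all = Q , Sublist.lookup Q⊑Z , unique-⊑ Q⊑Z uniqZ , Q>0 ,
        combine ⟦ Q ⊙ C ⊙ B ⟧ ⟦ Z ⟧ ⟦ Q ⟧ ⟦ Q ⊙ C ⟧ w₁ w₂ (f Q) (f (Q ⊙ C))
          (image-positive Z C Z>0 C>0) (image-positive Z B Z>0 B>0) Q>0
          (m≤m+n _ _)
          (petridis B C w₁ w₂ (unique-⊑ Q⊑Z uniqZ) (λ s → Q≤all (∈-sublists⁺ (Sublist.⊆-trans s Q⊑Z))) C cancel)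
          (m≤n+m _ _)
          (≤-trans Q≤Z (≤-reflexive (cong (_* ⟦ Q ⟧) (double w₁ w₂))))
    where
    w₁ w₂ : ℕ
    w₁ = ⟦ Z ⊙ C ⟧
    w₂ = ⟦ Z ⊙ B ⟧
    f : List G → ℕ
    f = weight B C w₁ w₂
    double : ∀ a b → a * b + b * a ≡ 2 * (a * b)
    double = solve-∀
    combine : ∀ t z q r w₁ w₂ F F′ → 1 ≤ w₁ → 1 ≤ w₂ → 1 ≤ q → w₁ * t ≤ F′ → F′ * q ≤ F * r → w₂ * r ≤ F →
      F * z ≤ 2 * (w₁ * w₂) * q → t * (z * z) ≤ 4 * (w₂ * w₁) * q
    combine t z q@(suc _) r w₁@(suc _) w₂@(suc _) F F′ _ _ _ h₁ h₂ h₃ h₄ =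
      *-cancelʳ-≤ _ _ (w₁ * (w₂ * q)) (begin
        t * (z * z) * (w₁ * (w₂ * q))                            ≡⟨ e₁ t z q w₁ w₂ ⟩
        (w₁ * t) * q * (w₂ * (z * z))                            ≤⟨ *-monoˡ-≤ (w₂ * (z * z)) (≤-trans (*-monoˡ-≤ q h₁) h₂) ⟩
        F * r * (w₂ * (z * z))                                   ≡⟨ e₂ F r w₂ z ⟩
        F * z * (w₂ * r * z)                                     ≤⟨ *-mono-≤ h₄ (≤-trans (*-monoˡ-≤ z h₃) h₄) ⟩
        2 * (w₁ * w₂) * q * (2 * (w₁ * w₂) * q)                  ≡⟨ e₃ w₁ w₂ q ⟩
        4 * (w₂ * w₁) * q * (w₁ * (w₂ * q))                      ∎)
      where
      open ≤-Reasoning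
      e₁ : ∀ t z q w₁ w₂ → t * (z * z) * (w₁ * (w₂ * q)) ≡ (w₁ * t) * q * (w₂ * (z * z))
      e₁ = solve-∀
      e₂ : ∀ F r w₂ z → F * r * (w₂ * (z * z)) ≡ F * z * (w₂ * r * z)
      e₂ = solve-∀
      e₃ : ∀ w₁ w₂ q → 2 * (w₁ * w₂) * q * (2 * (w₁ * w₂) * q) ≡ 4 * (w₂ * w₁) * q * (w₁ * (w₂ * q))
      e₃ = solve-∀

-- Integral domains

-- The library's ring solvers need coefficients that compute; over an abstract
-- ring we use integers, represented as reduced differences of naturals.
module IntegerCoefficientSolver (R : CommutativeRing 0ℓ 0ℓ) where

  open CommutativeRing R using (Carrier; _≈_; -_; 0#; 1#; setoid; semiring; ring; +-abelianGroup; -‿inverseʳ; -‿cong)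
    renaming (refl to ≈-refl; sym to ≈-sym; trans to ≈-trans; _+_ to _⊕_; _*_ to _⊛_; _-_ to _⊝_
      ; +-cong to ⊕-cong; +-congˡ to ⊕-congˡ; +-congʳ to ⊕-congʳ; +-identityˡ to ⊕-identityˡ; +-identityʳ to ⊕-identityʳ
      ; +-commutativeSemigroup to ⊕-commutativeSemigroup)
  open AbelianGroupProperties +-abelianGroup using (⁻¹-anti-homo‿-; ⁻¹-∙-comm)
  open RingProperties ring using (x[y-z]≈xy-xz; [y-z]x≈yx-zx)
  open Mult semiring using (×-homo-+; ×1-homo-*) renaming (_×_ to _·_)
  open SetoidReasoning setoid
  open CommutativeSemigroupProperties ⊕-commutativeSemigroup using (interchange)

  reduce : ℕ → ℕ → ℕ × ℕ
  reduce (suc a) (suc b) = reduce a b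
  reduce a       b       = a , b

  difference : ℕ × ℕ → Carrier
  difference (a , b) = a · 1# ⊝ b · 1#

  ⊕-‿interchange : ∀ u v w z → (u ⊕ w) ⊝ (v ⊕ z) ≈ (u ⊝ v) ⊕ (w ⊝ z)
  ⊕-‿interchange u v w z = begin
    (u ⊕ w) ⊝ (v ⊕ z)        ≈⟨ ⊕-congˡ (≈-sym (⁻¹-∙-comm v z)) ⟩
    (u ⊕ w) ⊕ (- v ⊕ - z)    ≈⟨ interchange u w (- v) (- z) ⟩
    (u ⊝ v) ⊕ (w ⊝ z)        ∎

  difference-reduce : ∀ a b → difference (reduce a b) ≈ a · 1# ⊝ b · 1#
  difference-reduce zero    b       = ≈-refl
  difference-reduce (suc a) zero    = ≈-refl
  difference-reduce (suc a) (suc b) = begin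
    difference (reduce a b)                    ≈⟨ difference-reduce a b ⟩
    a · 1# ⊝ b · 1#                            ≈⟨ ⊕-identityˡ _ ⟨
    0# ⊕ (a · 1# ⊝ b · 1#)                     ≈⟨ ⊕-congʳ (-‿inverseʳ 1#) ⟨
    (1# ⊝ 1#) ⊕ (a · 1# ⊝ b · 1#)              ≈⟨ ⊕-‿interchange 1# 1# (a · 1#) (b · 1#) ⟨
    (1# ⊕ a · 1#) ⊝ (1# ⊕ b · 1#)              ∎

  coefficients : RawRing 0ℓ 0ℓ
  coefficients = record
    { Carrier = ℕ × ℕ
    ; _≈_ = _≡_
    ; _+_ = λ { (a , b) (c , d) → reduce (a + c) (b + d) }
    ; _*_ = λ { (a , b) (c , d) → reduce (a * c + b * d) (a * d + b * c) }
    ; -_ = λ { (a , b) → b , a }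
    ; 0# = 0 , 0
    ; 1# = 1 , 0
    }

  -0≈0 : - 0# ≈ 0#
  -0≈0 = ≈-trans (≈-sym (⊕-identityˡ (- 0#))) (-‿inverseʳ 0#)

  homomorphism : coefficients -Raw-AlmostCommutative⟶ fromCommutativeRing R
  homomorphism = record
    { ⟦_⟧ = difference
    ; +-homo = λ { (a , b) (c , d) → begin
        difference (reduce (a + c) (b + d))              ≈⟨ difference-reduce (a + c) (b + d) ⟩
        (a + c) · 1# ⊝ (b + d) · 1#                      ≈⟨ ⊕-cong (×-homo-+ 1# a c) (-‿cong (×-homo-+ 1# b d)) ⟩
        (a · 1# ⊕ c · 1#) ⊝ (b · 1# ⊕ d · 1#)                ≈⟨ ⊕-‿interchange _ _ _ _ ⟩
        (a · 1# ⊝ b · 1#) ⊕ (c · 1# ⊝ d · 1#)                ∎ }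
    ; *-homo = λ { (a , b) (c , d) → begin
        difference (reduce (a * c + b * d) (a * d + b * c))
          ≈⟨ difference-reduce (a * c + b * d) (a * d + b * c) ⟩
        (a * c + b * d) · 1# ⊝ (a * d + b * c) · 1#
          ≈⟨ ⊕-cong (product-sum a c b d) (-‿cong (product-sum a d b c)) ⟩
        (a · 1# ⊛ c · 1# ⊕ b · 1# ⊛ d · 1#) ⊝ (a · 1# ⊛ d · 1# ⊕ b · 1# ⊛ c · 1#)
          ≈⟨ ⊕-‿interchange _ _ _ _ ⟩
        (a · 1# ⊛ c · 1# ⊝ a · 1# ⊛ d · 1#) ⊕ (b · 1# ⊛ d · 1# ⊝ b · 1# ⊛ c · 1#)
          ≈⟨ ⊕-congˡ (⁻¹-anti-homo‿- _ _) ⟨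
        (a · 1# ⊛ c · 1# ⊝ a · 1# ⊛ d · 1#) ⊝ (b · 1# ⊛ c · 1# ⊝ b · 1# ⊛ d · 1#)
          ≈⟨ ⊕-cong (x[y-z]≈xy-xz _ _ _) (-‿cong (x[y-z]≈xy-xz _ _ _)) ⟨
        a · 1# ⊛ (c · 1# ⊝ d · 1#) ⊝ b · 1# ⊛ (c · 1# ⊝ d · 1#)
          ≈⟨ [y-z]x≈yx-zx _ _ _ ⟨
        (a · 1# ⊝ b · 1#) ⊛ (c · 1# ⊝ d · 1#) ∎ }
    ; -‿homo = λ { (a , b) → ≈-sym (⁻¹-anti-homo‿- (a · 1#) (b · 1#)) }
    ; 0-homo = -‿inverseʳ 0#
    ; 1-homo = ≈-trans (⊕-congˡ -0≈0) (≈-trans (⊕-identityʳ _) (⊕-identityʳ 1#))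
    }
    where
    product-sum : ∀ a c b d → (a * c + b * d) · 1# ≈ a · 1# ⊛ c · 1# ⊕ b · 1# ⊛ d · 1#
    product-sum a c b d = ≈-trans (×-homo-+ 1# (a * c) (b * d)) (⊕-cong (×1-homo-* a c) (×1-homo-* b d))

  _coefficient≟_ : ∀ x y → Maybe (difference x ≈ difference y)
  (a , b) coefficient≟ (c , d) with a ≟ℕ c | b ≟ℕ d
  ... | yes refl | yes refl = just ≈-refl
  ... | _        | _        = nothing

  open RingSolver coefficients (fromCommutativeRing R) homomorphism _coefficient≟_ public
    using (solve; _:+_; _:*_; _:-_; :-_; _:=_)

module Domain (F : Set) (_≟_ : DecidableEquality F)
  (_⊕_ _⊛_ : F → F → F) (⊖_ : F → F) (𝟘 𝟏 : F) (isRing : IsCommutativeRing _≡_ _⊕_ _⊛_ ⊖_ 𝟘 𝟏)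
  (noZeroDivisors : ∀ x y → x ⊛ y ≡ 𝟘 → x ≡ 𝟘 ⊎ y ≡ 𝟘) where

  infixl 6 _⊝_
  _⊝_ : F → F → F
  x ⊝ y = x ⊕ (⊖ y)

  commutativeRing : CommutativeRing 0ℓ 0ℓ
  commutativeRing = record { isCommutativeRing = isRing }

  open IntegerCoefficientSolver commutativeRing
  open IsCommutativeRing isRing using (-‿inverseʳ; zeroˡ; zeroʳ)
    renaming (*-assoc to ⊛-assoc; *-comm to ⊛-comm; +-assoc to ⊕-assoc; +-comm to ⊕-comm
      ; +-identityʳ to ⊕-identityʳ; +-identityˡ to ⊕-identityˡ; *-identityʳ to ⊛-identityʳ; distribˡ to ⊛-distribˡ-⊕)
  open Image _≟_
  module Additive = Plünnecke _≟_ _⊕_ ⊕-assoc ⊕-comm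
  module Multiplicative = Plünnecke _≟_ _⊛_ ⊛-assoc ⊛-comm

  _≟²_ : DecidableEquality (F × F)
  _≟²_ = ≡-dec _≟_ _≟_

  ⊝≡𝟘⇒≡ : ∀ {x y} → x ⊝ y ≡ 𝟘 → x ≡ y
  ⊝≡𝟘⇒≡ {x} {y} h = trans (sym (solve 2 (λ x y → (x :- y) :+ y := x) refl x y)) (trans (cong (_⊕ y) h) (⊕-identityˡ y))

  ≡⇒⊝≡𝟘 : ∀ {x y} → x ≡ y → x ⊝ y ≡ 𝟘
  ≡⇒⊝≡𝟘 {x} refl = -‿inverseʳ x

  ⊕-cancelʳ : ∀ {x y} z → x ⊕ z ≡ y ⊕ z → x ≡ y
  ⊕-cancelʳ {x} {y} z h = ⊝≡𝟘⇒≡ (trans (sym (solve 3 (λ x y z → (x :+ z) :- (y :+ z) := x :- y) refl x y z)) (≡⇒⊝≡𝟘 h))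

  ⊝-cancelˡ : ∀ {x y} z → z ⊝ x ≡ z ⊝ y → x ≡ y
  ⊝-cancelˡ {x} {y} z h = ⊝≡𝟘⇒≡ (trans (sym (solve 3 (λ x y z → (z :- y) :- (z :- x) := x :- y) refl x y z)) (≡⇒⊝≡𝟘 (sym h)))

  ⊛-cancelˡ : ∀ {x y} z → z ≢ 𝟘 → z ⊛ x ≡ z ⊛ y → x ≡ y
  ⊛-cancelˡ {x} {y} z z≢0 h = [ (λ z≡0 → ⊥-elim (z≢0 z≡0)) , ⊝≡𝟘⇒≡ ]′
    (noZeroDivisors z (x ⊝ y) (trans (solve 3 (λ x y z → z :* (x :- y) := z :* x :- z :* y) refl x y z) (≡⇒⊝≡𝟘 h)))

  ⊛-cancelʳ : ∀ {x y} z → z ≢ 𝟘 → x ⊛ z ≡ y ⊛ z → x ≡ y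
  ⊛-cancelʳ {x} {y} z z≢0 h = ⊛-cancelˡ z z≢0 (trans (⊛-comm z x) (trans h (⊛-comm y z)))

  -- The map (y, q) ↦ (q - u, q - v) into T × T is injective: the difference of the coordinates
  -- returns y = u - v, and then the first coordinate returns q.
  ruzsa-triangle : {H Q T : List F} → Unique H → Unique Q →
    (∀ {y} → y ∈ H → ∃₂ λ u v → y ≡ u ⊝ v × (∀ {q} → q ∈ Q → q ⊝ u ∈ T × q ⊝ v ∈ T)) →
    length H * length Q ≤ length T * length T
  ruzsa-triangle {H} {Q} {T} uniqH uniqQ split = begin
    length H * length Q                  ≤⟨ fibre-lower R? (cartesianProduct T T) H 1 (length Q) uniqH (λ _ _ p q → trans (sym p) q) fibre ⟩
    1 * length (cartesianProduct T T)    ≡⟨ *-identityˡ _ ⟩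
    length (cartesianProduct T T)        ≡⟨ length-cartesianProduct T T ⟩
    length T * length T                  ∎
    where
    open ≤-Reasoning
    R? : ∀ (e : F × F) y → Dec (proj₂ e ⊝ proj₁ e ≡ y)
    R? e y = (proj₂ e ⊝ proj₁ e) ≟ y
    fibre : ∀ {y} → y ∈ H → length Q ≤ 1 * count (λ e → R? e y) (cartesianProduct T T)
    fibre y∈ with split y∈
    ... | u , v , refl , into = ≤-trans
      (length-≤-inj _≟²_ (λ q → q ⊝ u , q ⊝ v) uniqQ
        (λ _ _ eq → ⊕-cancelʳ (⊖ u) (cong proj₁ eq))
        (λ {q} q∈ → let l , r = into q∈ in ∈-filter⁺ (λ e → R? e (u ⊝ v)) (∈-cartesianProduct⁺ l r)
          (solve 3 (λ q u v → (q :- v) :- (q :- u) := u :- v) refl q u v)))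
      (≤-reflexive (sym (*-identityˡ _)))

  dilateSum : F → F → List F → List F
  dilateSum δ γ P = image₂ (λ p q → (δ ⊛ p) ⊕ (γ ⊛ q)) P P

  length-++-≤ : ∀ {xs ys : List F} {a b} X → length xs * X ≤ a → length ys * X ≤ b → length (xs ++ ys) * X ≤ a + b
  length-++-≤ {xs} {ys} X h k = ≤-trans (≤-reflexive (trans (cong (_* X) (length-++ xs)) (*-distribʳ-+ X (length xs) (length ys)))) (+-mono-≤ h k)

  -- (c − d)p + (a − b)q = (cp + aq) − (dp + bq), so Plünnecke's inequality for Z − aP, …, Z − dP
  -- and Ruzsa's triangle inequality apply.
  dilateSum-bound : (Z P : List F) → Unique Z → 1 ≤ length Z → 1 ≤ length P → ∀ X W {a b c d} →
    (∀ {x} → x ∈ a ∷ b ∷ c ∷ d ∷ [] → length (image₂ (λ z q → z ⊝ (x ⊛ q)) Z P) * X ≤ W) →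
    length (dilateSum (c ⊝ d) (a ⊝ b) P) * (length Z ^ 3 * X ^ 4) ≤ 16 * (4 * W) ^ 4
  dilateSum-bound Z P Z-unique Z>0 P>0 X W {a} {b} {c} {d} small =
    conclude (plünnecke {Z} {B} {B} Z-unique Z>0 B>0 B>0 (λ {x} _ → ⊕-cancelʳ x))
    where
    open Additive using (_⊙_; plünnecke)
    open ≤-Reasoning
    minus : F → List F
    minus x = map (λ p → ⊖ (x ⊛ p)) P
    -- A single set containing all four dilates serves as both summands, so `Q ⊙ B ⊙ B` contains
    -- every q - (cp + ap′) and q - (dp + bp′). The union costs the factor 4 in `4 * W`.
    B H : List F
    B = minus a ++ minus b ++ minus c ++ minus d
    H = dilateSum (c ⊝ d) (a ⊝ b) P
    ∈-minus : ∀ x {p} → p ∈ P → (⊖ (x ⊛ p)) ∈ minus x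
    ∈-minus x = ∈-map⁺ (λ p → ⊖ (x ⊛ p))
    ∈-a : ∀ {p} → p ∈ P → (⊖ (a ⊛ p)) ∈ B
    ∈-a p∈ = ∈-++⁺ˡ (∈-minus a p∈)
    ∈-b : ∀ {p} → p ∈ P → (⊖ (b ⊛ p)) ∈ B
    ∈-b p∈ = ∈-++⁺ʳ (minus a) (∈-++⁺ˡ (∈-minus b p∈))
    ∈-c : ∀ {p} → p ∈ P → (⊖ (c ⊛ p)) ∈ B
    ∈-c p∈ = ∈-++⁺ʳ (minus a) (∈-++⁺ʳ (minus b) (∈-++⁺ˡ (∈-minus c p∈)))
    ∈-d : ∀ {p} → p ∈ P → (⊖ (d ⊛ p)) ∈ B
    ∈-d p∈ = ∈-++⁺ʳ (minus a) (∈-++⁺ʳ (minus b) (∈-++⁺ʳ (minus c) (∈-minus d p∈)))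
    B>0 : 1 ≤ length B
    B>0 = ∈-length (∈-a (proj₂ (nonempty {xs = P} P>0)))
    translates : F → List F
    translates x = image₂ (λ z q → z ⊝ (x ⊛ q)) Z P
    into-translates : ∀ x {z y} → z ∈ Z → y ∈ minus x → z ⊕ y ∈ translates x
    into-translates x z∈ y∈ with ∈-map⁻ (λ p → ⊖ (x ⊛ p)) y∈
    ... | p , p∈ , refl = ∈-image₂⁺ (λ z q → z ⊝ (x ⊛ q)) z∈ p∈
    Z⊙B⊆ : Z ⊙ B ⊆ translates a ++ translates b ++ translates c ++ translates d
    Z⊙B⊆ e∈ with ∈-image₂⁻ _⊕_ Z B e∈
    ... | z , y , z∈ , y∈ , refl with ∈-++⁻ (minus a) y∈
    ...   | inj₁ i = ∈-++⁺ˡ (into-translates a z∈ i)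
    ...   | inj₂ y∈₁ with ∈-++⁻ (minus b) y∈₁
    ...     | inj₁ i = ∈-++⁺ʳ (translates a) (∈-++⁺ˡ (into-translates b z∈ i))
    ...     | inj₂ y∈₂ with ∈-++⁻ (minus c) y∈₂
    ...       | inj₁ i = ∈-++⁺ʳ (translates a) (∈-++⁺ʳ (translates b) (∈-++⁺ˡ (into-translates c z∈ i)))
    ...       | inj₂ i = ∈-++⁺ʳ (translates a) (∈-++⁺ʳ (translates b) (∈-++⁺ʳ (translates c) (into-translates d z∈ i)))
    Z⊙B-bound : length (Z ⊙ B) * X ≤ 4 * W
    Z⊙B-bound = begin
      length (Z ⊙ B) * X   ≤⟨ *-monoˡ-≤ X (length-≤-⊆ _≟_ (image₂-unique _⊕_ Z B) Z⊙B⊆) ⟩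
      length (translates a ++ translates b ++ translates c ++ translates d) * X
        ≤⟨ length-++-≤ {translates a} X (small (here refl)) (length-++-≤ {translates b} X (small (there (here refl)))
             (length-++-≤ {translates c} {translates d} X (small (there (there (here refl)))) (small (there (there (there (here refl))))))) ⟩
      W + (W + (W + W))    ≡⟨ four W ⟩
      4 * W                ∎
      where
      four : ∀ W → W + (W + (W + W)) ≡ 4 * W
      four = solve-∀
    split : ∀ {Q} → ∀ {y} → y ∈ H → ∃₂ λ u v → y ≡ u ⊝ v × (∀ {q} → q ∈ Q → q ⊝ u ∈ Q ⊙ B ⊙ B × q ⊝ v ∈ Q ⊙ B ⊙ B)
    split {Q} y∈ with ∈-image₂⁻ (λ p q → ((c ⊝ d) ⊛ p) ⊕ ((a ⊝ b) ⊛ q)) P P y∈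
    ... | p , q , p∈ , q∈ , refl = (c ⊛ p) ⊕ (a ⊛ q) , (d ⊛ p) ⊕ (b ⊛ q) ,
          solve 6 (λ a b c d p q → (c :- d) :* p :+ (a :- b) :* q := (c :* p :+ a :* q) :- (d :* p :+ b :* q)) refl a b c d p q ,
          (λ {e} e∈ → member e∈ (∈-c p∈) (∈-a q∈) , member e∈ (∈-d p∈) (∈-b q∈))
      where
      member : ∀ {e x y} → e ∈ Q → (⊖ x) ∈ B → (⊖ y) ∈ B → e ⊝ (x ⊕ y) ∈ Q ⊙ B ⊙ B
      member {e} {x} {y} e∈ x∈ y∈ = subst (_∈ (Q ⊙ B ⊙ B)) (solve 3 (λ e x y → (e :- x) :- y := e :- (x :+ y)) refl e x y)
        (∈-image₂⁺ _⊕_ (∈-image₂⁺ _⊕_ e∈ x∈) y∈)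
    -- Eliminating t leaves h z⁴ ≤ 16 V⁴ q, and q ≤ z removes one factor z.
    numbers : ∀ h q t z V → 1 ≤ q → 1 ≤ z → q ≤ z → h * q ≤ t * t → t * (z * z) ≤ 4 * (V * V) * q → h * z ^ 3 ≤ 16 * V ^ 4
    numbers h q t z V q>0 z>0 q≤z hq tz = *-cancelʳ-≤ _ _ (q * z) ⦃ >-nonZero (*-mono-≤ q>0 z>0) ⦄ (begin
      h * z ^ 3 * (q * z)                            ≡⟨ e₁ h q z ⟩
      h * q * (z * z * (z * z))                      ≤⟨ *-monoˡ-≤ (z * z * (z * z)) hq ⟩
      t * t * (z * z * (z * z))                      ≡⟨ e₂ t z ⟩
      t * (z * z) * (t * (z * z))                    ≤⟨ *-mono-≤ tz tz ⟩
      4 * (V * V) * q * (4 * (V * V) * q)            ≤⟨ *-monoʳ-≤ (4 * (V * V) * q) (*-monoʳ-≤ (4 * (V * V)) q≤z) ⟩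
      4 * (V * V) * q * (4 * (V * V) * z)            ≡⟨ e₃ V q z ⟩
      16 * V ^ 4 * (q * z)                           ∎)
      where
      e₁ : ∀ h q z → h * (z * (z * (z * 1))) * (q * z) ≡ h * q * (z * z * (z * z))
      e₁ = solve-∀
      e₂ : ∀ t z → t * t * (z * z * (z * z)) ≡ t * (z * z) * (t * (z * z))
      e₂ = solve-∀
      e₃ : ∀ V q z → 4 * (V * V) * q * (4 * (V * V) * z) ≡ 16 * (V * (V * (V * (V * 1)))) * (q * z)
      e₃ = solve-∀
    conclude : (∃ λ Q → Q ⊆ Z × Unique Q × 1 ≤ length Q ×
        length (Q ⊙ B ⊙ B) * (length Z * length Z) ≤ 4 * (length (Z ⊙ B) * length (Z ⊙ B)) * length Q) →
      length H * (length Z ^ 3 * X ^ 4) ≤ 16 * (4 * W) ^ 4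
    conclude (Q , Q⊆Z , Q-unique , Q>0 , h) = begin
      length H * (length Z ^ 3 * X ^ 4)     ≡⟨ *-assoc (length H) (length Z ^ 3) (X ^ 4) ⟨
      length H * length Z ^ 3 * X ^ 4       ≤⟨ *-monoˡ-≤ (X ^ 4) (numbers (length H) (length Q) (length (Q ⊙ B ⊙ B)) (length Z) (length (Z ⊙ B)) Q>0 Z>0
                                                 (length-≤-⊆ _≟_ Q-unique Q⊆Z) (ruzsa-triangle (image₂-unique _ P P) Q-unique (split {Q})) h) ⟩
      16 * length (Z ⊙ B) ^ 4 * X ^ 4       ≡⟨ trans (*-assoc 16 (length (Z ⊙ B) ^ 4) (X ^ 4)) (cong (16 *_) (sym (^-distribʳ-* 4 (length (Z ⊙ B)) X))) ⟩
      16 * (length (Z ⊙ B) * X) ^ 4         ≤⟨ *-monoʳ-≤ 16 (^-monoˡ-≤ 4 Z⊙B-bound) ⟩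
      16 * (4 * W) ^ 4                      ∎

  -- The pivot on ratios of differences

  module Pivot (elements : List F) (elements-unique : Unique elements) (complete : ∀ x → x ∈ elements)
    (descent : (T : F → Set) → T 𝟘 → (∀ x → T x → T (x ⊝ 𝟏)) → ∀ x → T x)
    (P : List F) (P-unique : Unique P) (P>0 : 1 ≤ length P)
    (P-small : length P * length P ≤ length elements) where

    differences : List F
    differences = image₂ _⊝_ P P

    m : ℕ
    m = length P

    m≤differences : m ≤ length differences
    m≤differences with nonempty {xs = P} P>0
    ... | p₀ , p₀∈ = length-≤-inj _≟_ (_⊝ p₀) P-unique (λ _ _ → ⊕-cancelʳ (⊖ p₀)) (λ p∈ → ∈-image₂⁺ _⊝_ p∈ p₀∈)

    -- ξ = (a - b)/(c - d) without division, as only a domain is assumed; a search through finitely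
    -- many quadruples then decides whether ξ is a ratio.
    Solves : F → (F × F) × (F × F) → Set
    Solves ξ ((a , b) , (c , d)) = c ≢ d × ξ ⊛ (c ⊝ d) ≡ a ⊝ b

    Ratio : F → Set
    Ratio ξ = Any (Solves ξ) (cartesianProduct (cartesianProduct P P) (cartesianProduct P P))

    ratio? : ∀ ξ → Dec (Ratio ξ)
    ratio? ξ = any? (λ { ((a , b) , (c , d)) → ¬? (c ≟ d) ×-dec ((ξ ⊛ (c ⊝ d)) ≟ (a ⊝ b)) }) _

    ratio⁺ : ∀ {ξ a b c d} → a ∈ P → b ∈ P → c ∈ P → d ∈ P → c ≢ d → ξ ⊛ (c ⊝ d) ≡ a ⊝ b → Ratio ξ
    ratio⁺ a∈ b∈ c∈ d∈ c≢d eq = lose (∈-cartesianProduct⁺ (∈-cartesianProduct⁺ a∈ b∈) (∈-cartesianProduct⁺ c∈ d∈)) (c≢d , eq)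

    record RatioWitness (ξ : F) : Set where
      field
        {a b c d} : F
        a∈ : a ∈ P
        b∈ : b ∈ P
        c∈ : c ∈ P
        d∈ : d ∈ P
        c≢d : c ≢ d
        equation : ξ ⊛ (c ⊝ d) ≡ a ⊝ b

    ratio⁻ : ∀ {ξ} → Ratio ξ → RatioWitness ξ
    ratio⁻ r with find r
    ... | ((a , b) , (c , d)) , e∈ , c≢d , eq with ∈-cartesianProduct⁻ (cartesianProduct P P) (cartesianProduct P P) e∈
    ...   | ab∈ , cd∈ with ∈-cartesianProduct⁻ P P ab∈ | ∈-cartesianProduct⁻ P P cd∈
    ...     | a∈ , b∈ | c∈ , d∈ = record { a∈ = a∈ ; b∈ = b∈ ; c∈ = c∈ ; d∈ = d∈ ; c≢d = c≢d ; equation = eq }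

    -- The common target of all branches of the pivot. The quadruple must lie in `P` for
    -- `dilateSum-bound` to apply to it later.
    Expands : Set
    Expands = ∃₂ λ a b → ∃₂ λ c d → a ∈ P × b ∈ P × c ∈ P × d ∈ P ×
      m * m * m ≤ 4 * (length differences * length (dilateSum (c ⊝ d) (a ⊝ b) P))

    -- If every ξ is a ratio, some ξ makes q + ξp collide no more often than on average.
    module AllRatios (all : ∀ ξ → Ratio ξ) where

      PP : List (F × F)
      PP = cartesianProduct P P

      N : ℕ
      N = length elements

      combine : F → F × F → F
      combine ξ (q , p) = q ⊕ (ξ ⊛ p)

      energy : F → ℕ
      energy ξ = ∑ PP (λ x → count (λ x′ → combine ξ x′ ≟ combine ξ x) PP)

      -- A collision says ζ(p′ - p) = q - q′. If p′ ≠ p this determines the multiplier ζ; if p′ = p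
      -- then also q′ = q.
      collision-unique : ∀ {x x′ ξ η} → x′ ≢ x → combine ξ x′ ≡ combine ξ x → combine η x′ ≡ combine η x → ξ ≡ η
      collision-unique {q , p} {q′ , p′} {ξ} {η} x′≢x h k with p′ ≟ p
      ... | yes refl = ⊥-elim (x′≢x (cong (_, p) (⊕-cancelʳ (ξ ⊛ p) h)))
      ... | no p′≢p  = ⊛-cancelʳ (p′ ⊝ p) (λ z → p′≢p (⊝≡𝟘⇒≡ z)) (trans (slope ξ h) (sym (slope η k)))
        where
        slope : ∀ ζ → q′ ⊕ (ζ ⊛ p′) ≡ q ⊕ (ζ ⊛ p) → ζ ⊛ (p′ ⊝ p) ≡ q ⊝ q′
        slope ζ e = trans (solve 5 (λ ζ p p′ q q′ → ζ :* (p′ :- p) := ((q′ :+ ζ :* p′) :- (q :+ ζ :* p)) :+ (q :- q′)) refl ζ p p′ q q′)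
          (trans (cong (_⊕ (q ⊝ q′)) (≡⇒⊝≡𝟘 e)) (⊕-identityˡ _))

      collisions : ∀ x x′ → count (λ ξ → combine ξ x′ ≟ combine ξ x) elements ≤ 1 + N * 𝟙 (x′ ≟² x)
      collisions x x′ with x′ ≟² x
      ... | yes _    = ≤-trans (length-filter _ elements) (≤-trans (≤-reflexive (sym (*-identityʳ N))) (n≤1+n _))
      ... | no x′≢x = ≤-trans (count-≤1 _ elements-unique (λ _ _ → collision-unique x′≢x)) (s≤s z≤n)

      PP≤N : length PP ≤ N
      PP≤N = ≤-trans (≤-reflexive (length-cartesianProduct P P)) P-small

      -- Off the diagonal a pair collides for at most one ξ, on it for all `N`. Since |P|² ≤ N, the
      -- first contribution is no larger than the second, whence the 2.
      average : ∑ elements energy ≤ N * (2 * length PP)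
      average = begin
        ∑ elements energy
          ≡⟨ ∑-swap elements PP (λ ξ x → count (λ x′ → combine ξ x′ ≟ combine ξ x) PP) ⟩
        ∑ PP (λ x → ∑ elements (λ ξ → count (λ x′ → combine ξ x′ ≟ combine ξ x) PP))
          ≡⟨ ∑-cong PP (λ x → count-double (λ ξ x′ → combine ξ x′ ≟ combine ξ x) elements PP) ⟩
        ∑ PP (λ x → ∑ PP (λ x′ → count (λ ξ → combine ξ x′ ≟ combine ξ x) elements))
          ≤⟨ ∑-mono PP (λ {x} _ → ∑-mono PP (λ {x′} _ → collisions x x′)) ⟩
        ∑ PP (λ x → ∑ PP (λ x′ → 1 + N * 𝟙 (x′ ≟² x)))
          ≤⟨ ∑-mono PP (λ {x} _ → row x) ⟩
        ∑ PP (λ _ → 2 * N)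
          ≡⟨ ∑-const PP (2 * N) ⟩
        length PP * (2 * N)
          ≡⟨ rearrange (length PP) N ⟩
        N * (2 * length PP) ∎
        where
        open ≤-Reasoning
        rearrange : ∀ k N → k * (2 * N) ≡ N * (2 * k)
        rearrange = solve-∀
        row : ∀ x → ∑ PP (λ x′ → 1 + N * 𝟙 (x′ ≟² x)) ≤ 2 * N
        row x = begin
          ∑ PP (λ x′ → 1 + N * 𝟙 (x′ ≟² x))                ≡⟨ ∑-+ PP (λ _ → 1) (λ x′ → N * 𝟙 (x′ ≟² x)) ⟩
          ∑ PP (λ _ → 1) + ∑ PP (λ x′ → N * 𝟙 (x′ ≟² x))   ≡⟨ cong₂ _+_ (∑-1 PP) (trans (∑-*ˡ PP N _) (cong (N *_) (sym (count-∑ (_≟² x) PP)))) ⟩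
          length PP + N * count (_≟² x) PP                 ≤⟨ +-mono-≤ PP≤N (*-monoʳ-≤ N (count-≤1 (_≟² x) (Uniq.cartesianProduct⁺ P-unique P-unique) (λ _ _ p q → trans p (sym q)))) ⟩
          N + N * 1                                        ≡⟨ cong (N +_) (*-comm N 1) ⟩
          2 * N                                            ∎

      expands : Expands
      expands with ∃-below-average elements energy (∈-length (complete 𝟘))
      ... | ξ , _ , low with ratio⁻ (all ξ)
      ...   | w = _ , _ , _ , _ , a∈ , b∈ , c∈ , d∈ ,
                  final m (length differences) (length (dilateSum (c ⊝ d) (a ⊝ b) P)) m≤differences
                    (≤-trans square (*-monoʳ-≤ 2 scaled))
        where
        open RatioWitness w
        sums : List F
        sums = image₂ (λ q p → combine ξ (q , p)) P P
        energy-small : energy ξ ≤ 2 * length PP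
        energy-small = *-cancelˡ-≤ N ⦃ >-nonZero (∈-length (complete 𝟘)) ⦄ (≤-trans low average)
        PP>0 : 1 ≤ length PP
        PP>0 = ≤-trans (*-mono-≤ P>0 P>0) (≤-reflexive (sym (length-cartesianProduct P P)))
        square : m * m ≤ 2 * length sums
        square = *-cancelʳ-≤ _ _ (length PP) ⦃ >-nonZero PP>0 ⦄ (begin
          m * m * length PP               ≡⟨ cong (_* length PP) (length-cartesianProduct P P) ⟨
          length PP * length PP           ≤⟨ energy-lower _≟_ (combine ξ) (image₂-unique _ P P) (λ x∈ → let q∈ , p∈ = ∈-cartesianProduct⁻ P P x∈ in ∈-image₂⁺ (λ q p → combine ξ (q , p)) q∈ p∈) ⟩
          length sums * energy ξ          ≤⟨ *-monoʳ-≤ (length sums) energy-small ⟩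
          length sums * (2 * length PP)   ≡⟨ rearrange (length sums) (length PP) ⟩
          2 * length sums * length PP     ∎)
          where
          open ≤-Reasoning
          rearrange : ∀ s k → s * (2 * k) ≡ 2 * s * k
          rearrange = solve-∀
        -- As ξ = (a - b)/(c - d), multiplication by c - d carries q + ξp into the dilate sum.
        scaled : length sums ≤ length (dilateSum (c ⊝ d) (a ⊝ b) P)
        scaled = length-≤-inj _≟_ ((c ⊝ d) ⊛_) (image₂-unique _ P P)
          (λ _ _ → ⊛-cancelˡ (c ⊝ d) (λ z → c≢d (⊝≡𝟘⇒≡ z)))
          into
          where
          into : ∀ {z} → z ∈ sums → (c ⊝ d) ⊛ z ∈ dilateSum (c ⊝ d) (a ⊝ b) P
          into z∈ with ∈-image₂⁻ (λ q p → combine ξ (q , p)) P P z∈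
          ... | q , p , q∈ , p∈ , refl = subst (_∈ dilateSum (c ⊝ d) (a ⊝ b) P)
            (trans (cong (λ t → ((c ⊝ d) ⊛ q) ⊕ (t ⊛ p)) (sym equation))
                   (solve 4 (λ δ ξ q p → δ :* q :+ (ξ :* δ) :* p := δ :* (q :+ ξ :* p)) refl (c ⊝ d) ξ q p))
            (∈-image₂⁺ (λ p q → ((c ⊝ d) ⊛ p) ⊕ ((a ⊝ b) ⊛ q)) q∈ p∈)
        -- The extra factor m ≤ |P - P| brings the bound to the form shared with the other branch.
        final : ∀ m D H → m ≤ D → m * m ≤ 2 * H → m * m * m ≤ 4 * (D * H)
        final m D H m≤D h = begin
          m * m * m       ≤⟨ *-mono-≤ h m≤D ⟩
          2 * H * D       ≤⟨ *-monoˡ-≤ D (*-monoˡ-≤ H (s≤s (s≤s (z≤n {2})))) ⟩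
          4 * H * D       ≡⟨ rearrange D H ⟩
          4 * (D * H)     ∎
          where
          open ≤-Reasoning
          rearrange : ∀ D H → 4 * H * D ≡ 4 * (D * H)
          rearrange = solve-∀

    -- Since r − 1 is not a ratio, the sums δq + (γ − δ)p are distinct, where r = γ/δ.
    escape : ∀ {r} → RatioWitness r → ¬ Ratio (r ⊝ 𝟏) → Expands
    escape {r} w ¬ratio = _ , _ , _ , _ , a∈ , b∈ , c∈ , d∈ , bound
      where
      open RatioWitness w
      open Additive using (_⊙_; plünnecke)
      δ γ : F
      δ = c ⊝ d
      γ = a ⊝ b
      δ≢0 : δ ≢ 𝟘
      δ≢0 z = c≢d (⊝≡𝟘⇒≡ z)
      Z B C : List F
      Z = map (δ ⊛_) P
      B = map (λ p → ⊖ (δ ⊛ p)) P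
      C = map (γ ⊛_) P
      mapped>0 : ∀ (f : F → F) → 1 ≤ length (map f P)
      mapped>0 f = ≤-trans P>0 (≤-reflexive (sym (length-map f P)))
      Z⊙B : length (Z ⊙ B) ≤ length differences
      Z⊙B = length-≤-by (λ z w → z ≟ (δ ⊛ w)) (Z ⊙ B) differences (image₂-unique _⊕_ Z B) into (λ _ _ p q → trans p (sym q))
        where
        into : ∀ {z} → z ∈ Z ⊙ B → ∃ λ w → w ∈ differences × z ≡ δ ⊛ w
        into z∈ with ∈-image₂⁻ _⊕_ Z B z∈
        ... | _ , _ , x∈ , y∈ , refl with ∈-map⁻ (δ ⊛_) x∈ | ∈-map⁻ (λ p → ⊖ (δ ⊛ p)) y∈
        ...   | p , p∈ , refl | q , q∈ , refl = p ⊝ q , ∈-image₂⁺ _⊝_ p∈ q∈ ,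
                solve 3 (λ δ p q → δ :* p :- δ :* q := δ :* (p :- q)) refl δ p q
      Z⊙C : length (Z ⊙ C) ≤ length (dilateSum δ γ P)
      Z⊙C = length-≤-⊆ _≟_ (image₂-unique _⊕_ Z C) into
        where
        into : Z ⊙ C ⊆ dilateSum δ γ P
        into z∈ with ∈-image₂⁻ _⊕_ Z C z∈
        ... | _ , _ , x∈ , y∈ , refl with ∈-map⁻ (δ ⊛_) x∈ | ∈-map⁻ (γ ⊛_) y∈
        ...   | p , p∈ , refl | q , q∈ , refl = ∈-image₂⁺ (λ p q → (δ ⊛ p) ⊕ (γ ⊛ q)) p∈ q∈
      -- A collision with p ≠ p′ rearranges to (r - 1)(p - p′) = q′ - q, which would make r - 1 a
      -- ratio.
      injective : ∀ {q q′ p p′} → q ∈ P → q′ ∈ P → p ∈ P → p′ ∈ P →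
        ((δ ⊛ q) ⊕ (γ ⊛ p)) ⊝ (δ ⊛ p) ≡ ((δ ⊛ q′) ⊕ (γ ⊛ p′)) ⊝ (δ ⊛ p′) → p ≡ p′
      injective {q} {q′} {p} {p′} q∈ q′∈ p∈ p′∈ h = decidable-stable (p ≟ p′) λ p≢p′ →
        ¬ratio (ratio⁺ q′∈ q∈ p∈ p′∈ p≢p′ (⊛-cancelˡ δ δ≢0 (begin
          δ ⊛ ((r ⊝ 𝟏) ⊛ (p ⊝ p′))                    ≡⟨ solve 5 (λ δ r o p p′ → δ :* ((r :- o) :* (p :- p′)) := (r :* δ) :* (p :- p′) :- (δ :* o) :* (p :- p′)) refl δ r 𝟏 p p′ ⟩
          ((r ⊛ δ) ⊛ (p ⊝ p′)) ⊝ ((δ ⊛ 𝟏) ⊛ (p ⊝ p′)) ≡⟨ cong₂ (λ s t → (s ⊛ (p ⊝ p′)) ⊝ (t ⊛ (p ⊝ p′))) equation (⊛-identityʳ δ) ⟩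
          (γ ⊛ (p ⊝ p′)) ⊝ (δ ⊛ (p ⊝ p′))             ≡⟨ solve 6 (λ δ γ q q′ p p′ → γ :* (p :- p′) :- δ :* (p :- p′) := (((δ :* q :+ γ :* p) :- δ :* p) :- ((δ :* q′ :+ γ :* p′) :- δ :* p′)) :+ δ :* (q′ :- q)) refl δ γ q q′ p p′ ⟩
          ((((δ ⊛ q) ⊕ (γ ⊛ p)) ⊝ (δ ⊛ p)) ⊝ (((δ ⊛ q′) ⊕ (γ ⊛ p′)) ⊝ (δ ⊛ p′))) ⊕ (δ ⊛ (q′ ⊝ q)) ≡⟨ cong (_⊕ (δ ⊛ (q′ ⊝ q))) (≡⇒⊝≡𝟘 h) ⟩
          𝟘 ⊕ (δ ⊛ (q′ ⊝ q))                          ≡⟨ ⊕-identityˡ _ ⟩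
          δ ⊛ (q′ ⊝ q)                                ∎)))
        where open ≡-Reasoning
      bound : m * m * m ≤ 4 * (length differences * length (dilateSum δ γ P))
      -- For these sets Z + B is a dilate of P - P and Z + C is the dilate sum. Since Q + C + B
      -- contains all x + (γ - δ)p with x in `Q`, it has at least |Q||P| elements, and |Q| cancels.
      bound = conclude (plünnecke {Z} {B} {C} (Uniq.map⁺ (⊛-cancelˡ δ δ≢0) P-unique) (mapped>0 (δ ⊛_)) (mapped>0 (λ p → ⊖ (δ ⊛ p))) (mapped>0 (γ ⊛_)) (λ {x} _ → ⊕-cancelʳ x))
        where
        conclude : (∃ λ Q → Q ⊆ Z × Unique Q × 1 ≤ length Q ×
            length (Q ⊙ C ⊙ B) * (length Z * length Z) ≤ 4 * (length (Z ⊙ B) * length (Z ⊙ C)) * length Q) →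
          m * m * m ≤ 4 * (length differences * length (dilateSum δ γ P))
        conclude (Q , Q⊆Z , Q-unique , Q>0 , h) = *-cancelʳ-≤ _ _ (length Q) ⦃ >-nonZero Q>0 ⦄ (begin
          m * m * m * length Q                                      ≡⟨ rearrange m (length Q) ⟩
          length Q * m * (m * m)                                    ≤⟨ *-monoˡ-≤ (m * m) distinct ⟩
          length (Q ⊙ C ⊙ B) * (m * m)                              ≡⟨ cong (λ k → length (Q ⊙ C ⊙ B) * (k * k)) (length-map (δ ⊛_) P) ⟨
          length (Q ⊙ C ⊙ B) * (length Z * length Z)                ≤⟨ h ⟩
          4 * (length (Z ⊙ B) * length (Z ⊙ C)) * length Q          ≤⟨ *-monoˡ-≤ (length Q) (*-monoʳ-≤ 4 (*-mono-≤ Z⊙B Z⊙C)) ⟩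
          4 * (length differences * length (dilateSum δ γ P)) * length Q ∎)
          where
          open ≤-Reasoning
          rearrange : ∀ m q → m * m * m * q ≡ q * m * (m * m)
          rearrange = solve-∀
          f : F × F → F
          f (x , p) = (x ⊕ (γ ⊛ p)) ⊝ (δ ⊛ p)
          f-injective : ∀ {x x′ p p′} → (∃ λ q → q ∈ P × x ≡ δ ⊛ q) → (∃ λ q → q ∈ P × x′ ≡ δ ⊛ q) →
            p ∈ P → p′ ∈ P → f (x , p) ≡ f (x′ , p′) → (x , p) ≡ (x′ , p′)
          f-injective (q , q∈ , refl) (q′ , q′∈ , refl) p∈ p′∈ eq = same (injective q∈ q′∈ p∈ p′∈ eq) eq
            where
            same : ∀ {x x′ p p′} → p ≡ p′ → f (x , p) ≡ f (x′ , p′) → (x , p) ≡ (x′ , p′)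
            same {p = p} refl eq = cong (_, p) (⊕-cancelʳ (γ ⊛ p) (⊕-cancelʳ (⊖ (δ ⊛ p)) eq))
          distinct : length Q * m ≤ length (Q ⊙ C ⊙ B)
          distinct = ≤-trans (≤-reflexive (sym (length-cartesianProduct Q P)))
            (length-≤-inj _≟_ f (Uniq.cartesianProduct⁺ Q-unique P-unique)
              (λ e∈ e′∈ → let x∈ , p∈ = ∈-cartesianProduct⁻ Q P e∈ ; x′∈ , p′∈ = ∈-cartesianProduct⁻ Q P e′∈ in
                f-injective (∈-map⁻ (δ ⊛_) (Q⊆Z x∈)) (∈-map⁻ (δ ⊛_) (Q⊆Z x′∈)) p∈ p′∈)
              (λ e∈ → let x∈ , p∈ = ∈-cartesianProduct⁻ Q P e∈ in
                ∈-image₂⁺ _⊕_ (∈-image₂⁺ _⊕_ x∈ (∈-map⁺ (γ ⊛_) p∈)) (∈-map⁺ (λ p → ⊖ (δ ⊛ p)) p∈)))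

    pivot : Expands
    pivot with nonempty {xs = P} P>0
    ... | p₀ , p₀∈ with any? (λ p → ¬? (p ≟ p₀)) P
    -- A one-element `P` has no ratios; the inequality holds because m ≤ 1 and both sets on the
    -- right are nonempty.
    ...   | no single = p₀ , p₀ , p₀ , p₀ , p₀∈ , p₀∈ , p₀∈ , p₀∈ ,
              (begin
                m * m * m    ≤⟨ *-mono-≤ (*-mono-≤ m≤1 m≤1) m≤1 ⟩
                1            ≤⟨ s≤s z≤n ⟩
                4            ≤⟨ *-monoʳ-≤ 4 (*-mono-≤ (≤-trans P>0 m≤differences) (∈-length (∈-image₂⁺ _ p₀∈ p₀∈))) ⟩
                4 * (length differences * length (dilateSum (p₀ ⊝ p₀) (p₀ ⊝ p₀) P)) ∎)
      where
      open ≤-Reasoning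
      m≤1 : m ≤ 1
      m≤1 = length-≤-⊆ _≟_ {ys = p₀ ∷ []} P-unique
        (λ {p} p∈ → here (decidable-stable (p ≟ p₀) (λ p≢p₀ → single (lose p∈ p≢p₀))))
    ...   | yes two with find two
    ...     | p₁ , p₁∈ , p₁≢p₀ with any? (λ ξ → ratio? ξ ×-dec ¬? (ratio? (ξ ⊝ 𝟏))) elements
    ...       | yes found = let ξ , _ , r , ¬r = find found in escape (ratio⁻ r) ¬r
    -- The ratios are closed under subtracting 1 and contain 0 = (p₀ - p₀)/(p₁ - p₀), so `descent`
    -- makes every element a ratio.
    ...       | no closed = AllRatios.expands (descent Ratio
                  (ratio⁺ p₀∈ p₀∈ p₁∈ p₀∈ p₁≢p₀ (trans (zeroˡ _) (sym (-‿inverseʳ p₀))))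
                  (λ ξ r → decidable-stable (ratio? (ξ ⊝ 𝟏)) (λ ¬r → closed (lose (complete ξ) (r , ¬r)))))

  -- Growth of A(A + 1) over a domain

  module Shift (A : List F) (A-unique : Unique A) (A>0 : 1 ≤ length A)
    (A≢𝟘 : ∀ {a} → a ∈ A → a ≢ 𝟘) (A+𝟏≢𝟘 : ∀ {a} → a ∈ A → a ⊕ 𝟏 ≢ 𝟘) where

    open DecMembership _≟_ using (_∈?_)

    n : ℕ
    n = length A

    A² : List (F × F)
    A² = cartesianProduct A A

    A²-unique : Unique A²
    A²-unique = Uniq.cartesianProduct⁺ A-unique A-unique

    S Y : List F
    S = image₂ (λ a b → a ⊛ (b ⊕ 𝟏)) A A
    Y = image₂ _⊛_ A A

    -- Writing s = Kn gives u = 4K²n²; the thresholds below are expressed through `u` and `n` in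
    -- place of powers of K.
    s u : ℕ
    s = length S
    u = 4 * (s * s)

    n≤s : n ≤ s
    n≤s with nonempty {xs = A} A>0
    ... | b , b∈ = length-≤-inj _≟_ (_⊛ (b ⊕ 𝟏)) A-unique (λ _ _ → ⊛-cancelʳ (b ⊕ 𝟏) (A+𝟏≢𝟘 b∈))
                     (λ a∈ → ∈-image₂⁺ (λ a b → a ⊛ (b ⊕ 𝟏)) a∈ b∈)

    n²≤u : n * n ≤ u
    n²≤u = ≤-trans (*-mono-≤ n≤s n≤s) (m≤m+n (s * s) _)

    u>0 : 1 ≤ u
    u>0 = ≤-trans (*-mono-≤ A>0 A>0) n²≤u

    -- Multiplicative Plünnecke for Z = A + 1 with both summands A, since ZA lies in `S`. Any q in
    -- `Q` is nonzero, so the dilate qAA inside QAA already has |AA| elements.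
    product-set-bound : length Y * n ≤ u
    product-set-bound = conclude (plünnecke {Z} {A} {A} (Uniq.map⁺ (⊕-cancelʳ 𝟏) A-unique) Z>0 A>0 A>0
        (λ {a} a∈ → ⊛-cancelʳ a (A≢𝟘 a∈)))
      where
      open Multiplicative using (_⊙_; plünnecke)
      open ≤-Reasoning
      Z : List F
      Z = map (_⊕ 𝟏) A
      Z≡n : length Z ≡ n
      Z≡n = length-map (_⊕ 𝟏) A
      Z>0 : 1 ≤ length Z
      Z>0 = ≤-trans A>0 (≤-reflexive (sym Z≡n))
      Z⊙A≤s : length (Z ⊙ A) ≤ s
      Z⊙A≤s = length-≤-⊆ _≟_ (image₂-unique _⊛_ Z A) into
        where
        into : Z ⊙ A ⊆ S
        into z∈ with ∈-image₂⁻ _⊛_ Z A z∈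
        ... | _ , a , x∈ , a∈ , refl with ∈-map⁻ (_⊕ 𝟏) x∈
        ...   | b , b∈ , refl = subst (_∈ S) (⊛-comm a (b ⊕ 𝟏)) (∈-image₂⁺ (λ a b → a ⊛ (b ⊕ 𝟏)) a∈ b∈)
      nonzero : ∀ {x} → x ∈ Z → x ≢ 𝟘
      nonzero x∈ with ∈-map⁻ (_⊕ 𝟏) x∈
      ... | b , b∈ , refl = A+𝟏≢𝟘 b∈
      rearrange : ∀ y n → y * n * n ≡ y * (n * n)
      rearrange = solve-∀
      conclude : (∃ λ Q → Q ⊆ Z × Unique Q × 1 ≤ length Q ×
          length (Q ⊙ A ⊙ A) * (length Z * length Z) ≤ 4 * (length (Z ⊙ A) * length (Z ⊙ A)) * length Q) →
        length Y * n ≤ u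
      conclude (Q , Q⊆Z , Q-unique , Q>0 , h) = *-cancelʳ-≤ _ _ n ⦃ >-nonZero A>0 ⦄ (begin
        length Y * n * n                                       ≡⟨ rearrange (length Y) n ⟩
        length Y * (n * n)                                     ≤⟨ *-monoˡ-≤ (n * n) (embed (nonempty {xs = Q} Q>0)) ⟩
        length (Q ⊙ A ⊙ A) * (n * n)                           ≡⟨ cong (λ k → length (Q ⊙ A ⊙ A) * (k * k)) Z≡n ⟨
        length (Q ⊙ A ⊙ A) * (length Z * length Z)             ≤⟨ h ⟩
        4 * (length (Z ⊙ A) * length (Z ⊙ A)) * length Q       ≤⟨ *-mono-≤ (*-monoʳ-≤ 4 (*-mono-≤ Z⊙A≤s Z⊙A≤s)) (≤-trans (length-≤-⊆ _≟_ Q-unique Q⊆Z) (≤-reflexive Z≡n)) ⟩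
        u * n                                                  ∎)
        where
        embed : (∃ λ q → q ∈ Q) → length Y ≤ length (Q ⊙ A ⊙ A)
        embed (q , q∈) = length-≤-inj _≟_ (q ⊛_) (image₂-unique _⊛_ A A) (λ _ _ → ⊛-cancelˡ q (nonzero (Q⊆Z q∈))) into
          where
          into : ∀ {z} → z ∈ Y → q ⊛ z ∈ Q ⊙ A ⊙ A
          into z∈ with ∈-image₂⁻ _⊛_ A A z∈
          ... | a , b , a∈ , b∈ , refl = subst (_∈ (Q ⊙ A ⊙ A)) (⊛-assoc q a b) (∈-image₂⁺ _⊛_ (∈-image₂⁺ _⊛_ q∈ a∈) b∈)

    Joins : F → F → F → Set
    Joins y y′ x = y ∈ map (x ⊛_) A × y′ ∈ map (x ⊛_) A

    joins? : ∀ y y′ x → Dec (Joins y y′ x)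
    joins? y y′ x = (y ∈? map (x ⊛_) A) ×-dec (y′ ∈? map (x ⊛_) A)

    codegree : F → F → ℕ
    codegree y y′ = count (joins? y y′) A

    -- If x joins y and y′ then x + y and x + y′ lie in S, so codegree y y′ counts
    -- representations of y − y′ as a difference of two elements of S.
    x⊕y∈S : ∀ {x y} → x ∈ A → y ∈ map (x ⊛_) A → x ⊕ y ∈ S
    x⊕y∈S {x} x∈ y∈ with ∈-map⁻ (x ⊛_) y∈
    ... | q , q∈ , refl = subst (_∈ S)
      (trans (⊛-distribˡ-⊕ x q 𝟏) (trans (cong ((x ⊛ q) ⊕_) (⊛-identityʳ x)) (⊕-comm (x ⊛ q) x)))
      (∈-image₂⁺ (λ a b → a ⊛ (b ⊕ 𝟏)) x∈ q∈)

    module Popular (τ T : ℕ) where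

      -- Codegree below T / τ. The values used later are T = n⁷ and τ = 16u³, a threshold of order n
      -- / K⁶.
      Rare : F → F → Set
      Rare y y′ = τ * codegree y y′ < T

      rare? : ∀ y y′ → Dec (Rare y y′)
      rare? y y′ = τ * codegree y y′ <? T

      rareDegree : F → F → ℕ
      rareDegree a p = count (λ q → rare? (a ⊛ p) (a ⊛ q)) A

      -- A rare pair (y, y′) comes from at most `codegree y y′` triples (a, p, q), because a ≠ 0
      -- determines p and q; rarity caps this number by T / τ.
      rare-total : τ * ∑ A (λ a → ∑ A (rareDegree a)) ≤ length Y * length Y * T
      rare-total = begin
        τ * ∑ A (λ a → ∑ A (rareDegree a))       ≡⟨ cong (τ *_) (∑-cong A (λ a → sym (count-× (λ pq → rare? (a ⊛ proj₁ pq) (a ⊛ proj₂ pq)) A A))) ⟩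
        τ * ∑ A (λ a → count (λ pq → rare? (a ⊛ proj₁ pq) (a ⊛ proj₂ pq)) A²)  ≡⟨ cong (τ *_) (sym (count-× rare³? A A²)) ⟩
        τ * length triples                       ≤⟨ fibre-upper R? triples pairs τ T total small ⟩
        length pairs * T                         ≤⟨ *-monoˡ-≤ T (length-filter (λ yy′ → rare? (proj₁ yy′) (proj₂ yy′)) (cartesianProduct Y Y)) ⟩
        length (cartesianProduct Y Y) * T        ≡⟨ cong (_* T) (length-cartesianProduct Y Y) ⟩
        length Y * length Y * T                  ∎
        where
        open ≤-Reasoning
        rare³? : ∀ (t : F × F × F) → Dec (Rare (proj₁ t ⊛ proj₁ (proj₂ t)) (proj₁ t ⊛ proj₂ (proj₂ t)))
        rare³? (a , p , q) = rare? (a ⊛ p) (a ⊛ q)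
        triples : List (F × F × F)
        triples = filter rare³? (cartesianProduct A A²)
        pairs : List (F × F)
        pairs = filter (λ yy′ → rare? (proj₁ yy′) (proj₂ yy′)) (cartesianProduct Y Y)
        R : F × F × F → F × F → Set
        R (a , p , q) yy′ = (a ⊛ p , a ⊛ q) ≡ yy′
        R? : ∀ t yy′ → Dec (R t yy′)
        R? (a , p , q) yy′ = (a ⊛ p , a ⊛ q) ≟² yy′
        triple⁻ : ∀ {a p q} → (a , p , q) ∈ triples → a ∈ A × p ∈ A × q ∈ A × Rare (a ⊛ p) (a ⊛ q)
        triple⁻ t∈ =
          let t∈′ , rare = ∈-filter⁻ rare³? {xs = cartesianProduct A A²} t∈
              a∈ , pq∈ = ∈-cartesianProduct⁻ A A² t∈′
              p∈ , q∈ = ∈-cartesianProduct⁻ A A pq∈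
          in a∈ , p∈ , q∈ , rare
        total : ∀ {t} → t ∈ triples → ∃ λ yy′ → yy′ ∈ pairs × R t yy′
        total {a , p , q} t∈ = let a∈ , p∈ , q∈ , rare = triple⁻ t∈ in
          (a ⊛ p , a ⊛ q) ,
          ∈-filter⁺ (λ yy′ → rare? (proj₁ yy′) (proj₂ yy′)) (∈-cartesianProduct⁺ (∈-image₂⁺ _⊛_ a∈ p∈) (∈-image₂⁺ _⊛_ a∈ q∈)) rare ,
          refl
        small : ∀ {yy′} → yy′ ∈ pairs → τ * count (λ t → R? t yy′) triples ≤ T
        small {y , y′} yy′∈ = ≤-trans (*-monoʳ-≤ τ fibre)
          (<⇒≤ (proj₂ (∈-filter⁻ (λ yy′ → rare? (proj₁ yy′) (proj₂ yy′)) {xs = cartesianProduct Y Y} yy′∈)))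
          where
          fibre⁻ : ∀ {t} → t ∈ filter (λ t → R? t (y , y′)) triples → t ∈ triples × R t (y , y′)
          fibre⁻ = ∈-filter⁻ (λ t → R? t (y , y′)) {xs = triples}
          determined : ∀ {a p q p′ q′ e} → a ≢ 𝟘 → R (a , p , q) e → R (a , p′ , q′) e → (a , p , q) ≡ (a , p′ , q′)
          determined {a} a≢0 h k = cong₂ (λ p q → a , p , q)
            (⊛-cancelˡ a a≢0 (cong proj₁ (trans h (sym k)))) (⊛-cancelˡ a a≢0 (cong proj₂ (trans h (sym k))))
          injective : ∀ {t t′} → t ∈ filter (λ t → R? t (y , y′)) triples → t′ ∈ filter (λ t → R? t (y , y′)) triples →
            proj₁ t ≡ proj₁ t′ → t ≡ t′
          injective {a , p , q} {.a , p′ , q′} t∈ t′∈ refl =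
            determined (A≢𝟘 (proj₁ (triple⁻ (proj₁ (fibre⁻ t∈))))) (proj₂ (fibre⁻ t∈)) (proj₂ (fibre⁻ t′∈))
          into : ∀ {t} → t ∈ filter (λ t → R? t (y , y′)) triples → proj₁ t ∈ filter (joins? y y′) A
          into {a , p , q} t∈ =
            let t∈′ , r = fibre⁻ t∈
                a∈ , p∈ , q∈ , _ = triple⁻ t∈′
            in ∈-filter⁺ (joins? y y′) a∈
                 (subst (_∈ map (a ⊛_) A) (cong proj₁ r) (∈-map⁺ (a ⊛_) p∈) , subst (_∈ map (a ⊛_) A) (cong proj₂ r) (∈-map⁺ (a ⊛_) q∈))
          fibre : count (λ t → R? t (y , y′)) triples ≤ codegree y y′
          fibre = length-≤-inj _≟_ proj₁
            (Uniq.filter⁺ (λ t → R? t (y , y′)) (Uniq.filter⁺ rare³? (Uniq.cartesianProduct⁺ A-unique A²-unique)))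
            injective into

      module Centre {a₀ : F} (a₀∈ : a₀ ∈ A) (w k : ℕ) where

        a₀≢0 : a₀ ≢ 𝟘
        a₀≢0 = A≢𝟘 a₀∈

        -- Later w = 8u and k = n³: at most n³ / (8u), of order n / K², of the pairs (a₀p, a₀q) may
        -- be rare.
        core? : ∀ p → Dec (w * rareDegree a₀ p ≤ k)
        core? p = w * rareDegree a₀ p ≤? k

        P : List F
        P = filter core? A

        P⊆A : P ⊆ A
        P⊆A p∈ = proj₁ (∈-filter⁻ core? {xs = A} p∈)

        P-unique : Unique P
        P-unique = Uniq.filter⁺ core? A-unique

        few-rare : ∀ {p} → p ∈ P → w * rareDegree a₀ p ≤ k
        few-rare p∈ = proj₂ (∈-filter⁻ core? {xs = A} p∈)

        Coincide : F → F → F × F → Set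
        Coincide a b (p , z) = b ⊛ z ≡ a ⊛ p

        coincide? : ∀ a b pz → Dec (Coincide a b pz)
        coincide? a b (p , z) = (b ⊛ z) ≟ (a ⊛ p)

        -- The size of aA ∩ bA when a and b are nonzero.
        coincidences : F → F → ℕ
        coincidences a b = count (coincide? a b) A²

        proj₁-injective : ∀ {a b} → b ∈ A → ∀ {e e′} → Coincide a b e → Coincide a b e′ → proj₁ e ≡ proj₁ e′ → e ≡ e′
        proj₁-injective {a} {b} b∈ {p , z} {.p , z′} h h′ refl = cong (p ,_) (⊛-cancelˡ b (A≢𝟘 b∈) (trans h (sym h′)))

        proj₂-injective : ∀ {a b} → a ∈ A → ∀ {e e′} → Coincide a b e → Coincide a b e′ → proj₂ e ≡ proj₂ e′ → e ≡ e′
        proj₂-injective {a} {b} a∈ {p , z} {p′ , .z} h h′ refl = cong (_, z) (⊛-cancelˡ a (A≢𝟘 a∈) (trans (sym h) h′))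

        differenceSet : F → F → List F
        differenceSet a b = image₂ (λ p z → (a ⊛ p) ⊝ (b ⊛ z)) P P

        S² : List (F × F)
        S² = cartesianProduct S S

        S⁴ : List ((F × F) × (F × F))
        S⁴ = cartesianProduct S² S²

        length-S⁴ : length S⁴ ≡ s * s * (s * s)
        length-S⁴ = trans (length-cartesianProduct S² S²) (cong₂ _*_ (length-cartesianProduct S S) (length-cartesianProduct S S))

        -- a₀(ap − bz) = a(a₀p − a₀p′) + b(a₀z′ − a₀z) whenever ap′ = bz′, and for most such
        -- (p′, z′) both inner differences have many representations in S − S.
        module Representations {a b : F} (a∈ : a ∈ A) (b∈ : b ∈ A) where

          Represents : (F × F) × (F × F) → F → Set
          Represents ((s₁ , s₂) , (s₃ , s₄)) v = (a ⊛ (s₁ ⊝ s₂)) ⊕ (b ⊛ (s₃ ⊝ s₄)) ≡ a₀ ⊛ v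

          represents? : ∀ σ v → Dec (Represents σ v)
          represents? ((s₁ , s₂) , (s₃ , s₄)) v = ((a ⊛ (s₁ ⊝ s₂)) ⊕ (b ⊛ (s₃ ⊝ s₄))) ≟ (a₀ ⊛ v)

          module _ {p z : F} (p∈ : p ∈ P) (z∈ : z ∈ P) where

            v : F
            v = (a ⊛ p) ⊝ (b ⊛ z)

            fibre : List ((F × F) × (F × F))
            fibre = filter (λ σ → represents? σ v) S⁴

            rareˡ? : ∀ (e : F × F) → Dec (Rare (a₀ ⊛ p) (a₀ ⊛ proj₁ e))
            rareˡ? e = rare? (a₀ ⊛ p) (a₀ ⊛ proj₁ e)

            rareʳ? : ∀ (e : F × F) → Dec (Rare (a₀ ⊛ z) (a₀ ⊛ proj₂ e))
            rareʳ? e = rare? (a₀ ⊛ z) (a₀ ⊛ proj₂ e)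

            left? : ∀ (e : F × F) → Dec (Coincide a b e × Rare (a₀ ⊛ p) (a₀ ⊛ proj₁ e))
            left? e = coincide? a b e ×-dec rareˡ? e

            right? : ∀ (e : F × F) → Dec (Coincide a b e × Rare (a₀ ⊛ z) (a₀ ⊛ proj₂ e))
            right? e = coincide? a b e ×-dec rareʳ? e

            good? : ∀ (e : F × F) → Dec (Coincide a b e × ¬ Rare (a₀ ⊛ p) (a₀ ⊛ proj₁ e) × ¬ Rare (a₀ ⊛ z) (a₀ ⊛ proj₂ e))
            good? e = coincide? a b e ×-dec (¬? (rareˡ? e) ×-dec ¬? (rareʳ? e))

            good : List (F × F)
            good = filter good? A²

            -- Under a coincidence the first coordinate determines the second, as b ≠ 0; so spoiled
            -- pairs inject into the rare partners of p.
            left-bound : count left? A² ≤ rareDegree a₀ p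
            left-bound = length-≤-inj _≟_ proj₁ (Uniq.filter⁺ left? A²-unique)
              (λ e∈ e′∈ → proj₁-injective b∈ (proj₁ (unpack e∈)) (proj₁ (unpack e′∈)))
              (λ e∈ → let _ , rare , e∈A² = unpack e∈ in
                ∈-filter⁺ (λ q → rare? (a₀ ⊛ p) (a₀ ⊛ q)) (proj₁ (∈-cartesianProduct⁻ A A e∈A²)) rare)
              where
              unpack : ∀ {e} → e ∈ filter left? A² → Coincide a b e × Rare (a₀ ⊛ p) (a₀ ⊛ proj₁ e) × e ∈ A²
              unpack e∈ = let e∈A² , c , r = ∈-filter⁻ left? {xs = A²} e∈ in c , r , e∈A²

            right-bound : count right? A² ≤ rareDegree a₀ z
            right-bound = length-≤-inj _≟_ proj₂ (Uniq.filter⁺ right? A²-unique)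
              (λ e∈ e′∈ → proj₂-injective a∈ (proj₁ (unpack e∈)) (proj₁ (unpack e′∈)))
              (λ e∈ → let _ , rare , e∈A² = unpack e∈ in
                ∈-filter⁺ (λ q → rare? (a₀ ⊛ z) (a₀ ⊛ q)) (proj₂ (∈-cartesianProduct⁻ A A e∈A²)) rare)
              where
              unpack : ∀ {e} → e ∈ filter right? A² → Coincide a b e × Rare (a₀ ⊛ z) (a₀ ⊛ proj₂ e) × e ∈ A²
              unpack e∈ = let e∈A² , c , r = ∈-filter⁻ right? {xs = A²} e∈ in c , r , e∈A²

            coincidences-split : coincidences a b ≤ count left? A² + (count right? A² + length good)
            coincidences-split = ≤-trans
              (count-⊎ (coincide? a b) left? (λ e → coincide? a b e ×-dec ¬? (rareˡ? e)) A²
                (λ _ c ¬l → c , λ r → ¬l (c , r)))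
              (+-monoʳ-≤ (count left? A²)
                (count-⊎ (λ e → coincide? a b e ×-dec ¬? (rareˡ? e)) right? good? A²
                  (λ _ c ¬r → proj₁ c , proj₂ c , λ r → ¬r (proj₁ c , r))))

            -- Each side spoils at most k / w coincidences, so 2k / w of the assumed 4k / w survive.
            good-many : 4 * k ≤ w * coincidences a b → 2 * k ≤ w * length good
            good-many h = +-cancelʳ-≤ (2 * k) _ _ (begin
              2 * k + 2 * k                                     ≡⟨ double k ⟩
              4 * k                                             ≤⟨ h ⟩
              w * coincidences a b                              ≤⟨ *-monoʳ-≤ w (≤-trans coincidences-split (+-mono-≤ left-bound (+-monoˡ-≤ (length good) right-bound))) ⟩
              w * (rareDegree a₀ p + (rareDegree a₀ z + length good)) ≡⟨ distribute w (rareDegree a₀ p) (rareDegree a₀ z) (length good) ⟩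
              w * length good + (w * rareDegree a₀ p + w * rareDegree a₀ z) ≤⟨ +-monoʳ-≤ (w * length good) (+-mono-≤ (few-rare p∈) (few-rare z∈)) ⟩
              w * length good + (k + k)                         ≡⟨ cong (w * length good +_) (cong (k +_) (sym (+-identityʳ k))) ⟩
              w * length good + 2 * k                           ∎)
              where
              open ≤-Reasoning
              double : ∀ k → 2 * k + 2 * k ≡ 4 * k
              double = solve-∀
              distribute : ∀ w x y g → w * (x + (y + g)) ≡ w * g + (w * x + w * y)
              distribute = solve-∀

            -- Records which pair (p′, z′) a representation comes from; since a₀ ≠ 0, the two
            -- differences allow it to be recovered.
            Through : (F × F) × (F × F) → F × F → Set
            Through ((s₁ , s₂) , (s₃ , s₄)) (p′ , z′) =
              s₁ ⊝ s₂ ≡ (a₀ ⊛ p) ⊝ (a₀ ⊛ p′) × s₃ ⊝ s₄ ≡ (a₀ ⊛ z′) ⊝ (a₀ ⊛ z)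

            through? : ∀ σ e → Dec (Through σ e)
            through? ((s₁ , s₂) , (s₃ , s₄)) (p′ , z′) =
              ((s₁ ⊝ s₂) ≟ ((a₀ ⊛ p) ⊝ (a₀ ⊛ p′))) ×-dec ((s₃ ⊝ s₄) ≟ ((a₀ ⊛ z′) ⊝ (a₀ ⊛ z)))

            through-functional : ∀ {σ e e′} → Through σ e → Through σ e′ → e ≡ e′
            through-functional (h₁ , h₂) (k₁ , k₂) = cong₂ _,_
              (⊛-cancelˡ a₀ a₀≢0 (⊝-cancelˡ (a₀ ⊛ p) (trans (sym h₁) k₁)))
              (⊛-cancelˡ a₀ a₀≢0 (⊕-cancelʳ (⊖ (a₀ ⊛ z)) (trans (sym h₂) k₂)))

            translate : ∀ x α β → (x ⊕ α) ⊝ (x ⊕ β) ≡ α ⊝ β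
            translate = solve 3 (λ x α β → (x :+ α) :- (x :+ β) := α :- β) refl

            module _ {p′ z′ : F} (coincide : b ⊛ z′ ≡ a ⊛ p′) where

              representation : F × F → (F × F) × (F × F)
              representation (x , x′) = (x ⊕ (a₀ ⊛ p) , x ⊕ (a₀ ⊛ p′)) , (x′ ⊕ (a₀ ⊛ z′) , x′ ⊕ (a₀ ⊛ z))

              representation-injective : ∀ {e e′} → representation e ≡ representation e′ → e ≡ e′
              representation-injective h = cong₂ _,_
                (⊕-cancelʳ (a₀ ⊛ p) (cong (λ σ → proj₁ (proj₁ σ)) h)) (⊕-cancelʳ (a₀ ⊛ z′) (cong (λ σ → proj₁ (proj₂ σ)) h))

              representation-represents : ∀ e → Represents (representation e) v
              representation-represents (x , x′) = begin
                (a ⊛ ((x ⊕ (a₀ ⊛ p)) ⊝ (x ⊕ (a₀ ⊛ p′)))) ⊕ (b ⊛ ((x′ ⊕ (a₀ ⊛ z′)) ⊝ (x′ ⊕ (a₀ ⊛ z))))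
                  ≡⟨ cong₂ (λ α β → (a ⊛ α) ⊕ (b ⊛ β)) (translate x _ _) (translate x′ _ _) ⟩
                (a ⊛ ((a₀ ⊛ p) ⊝ (a₀ ⊛ p′))) ⊕ (b ⊛ ((a₀ ⊛ z′) ⊝ (a₀ ⊛ z)))
                  ≡⟨ solve 7 (λ a b a₀ p z p′ z′ → a :* (a₀ :* p :- a₀ :* p′) :+ b :* (a₀ :* z′ :- a₀ :* z)
                       := a₀ :* (a :* p :- b :* z) :+ a₀ :* (b :* z′ :- a :* p′)) refl a b a₀ p z p′ z′ ⟩
                (a₀ ⊛ v) ⊕ (a₀ ⊛ ((b ⊛ z′) ⊝ (a ⊛ p′)))
                  ≡⟨ cong (λ t → (a₀ ⊛ v) ⊕ (a₀ ⊛ t)) (≡⇒⊝≡𝟘 coincide) ⟩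
                (a₀ ⊛ v) ⊕ (a₀ ⊛ 𝟘)
                  ≡⟨ cong ((a₀ ⊛ v) ⊕_) (zeroʳ a₀) ⟩
                (a₀ ⊛ v) ⊕ 𝟘
                  ≡⟨ ⊕-identityʳ (a₀ ⊛ v) ⟩
                a₀ ⊛ v ∎
                where open ≡-Reasoning

              -- Independent choices of x joining a₀p to a₀p′ and of x′ joining a₀z to a₀z′ give
              -- distinct representations.
              codegrees≤ : codegree (a₀ ⊛ p) (a₀ ⊛ p′) * codegree (a₀ ⊛ z) (a₀ ⊛ z′) ≤ count (λ σ → through? σ (p′ , z′)) fibre
              codegrees≤ = ≤-trans (≤-reflexive (sym (length-cartesianProduct J J′)))
                (length-≤-inj (≡-dec _≟²_ _≟²_) representation
                  (Uniq.cartesianProduct⁺ (Uniq.filter⁺ j? A-unique) (Uniq.filter⁺ j′? A-unique))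
                  (λ _ _ → representation-injective) into)
                where
                j? = joins? (a₀ ⊛ p) (a₀ ⊛ p′)
                j′? = joins? (a₀ ⊛ z) (a₀ ⊛ z′)
                J J′ : List F
                J = filter j? A
                J′ = filter j′? A
                into : ∀ {e} → e ∈ cartesianProduct J J′ → representation e ∈ filter (λ σ → through? σ (p′ , z′)) fibre
                into {x , x′} e∈ =
                  let x∈J , x′∈J′ = ∈-cartesianProduct⁻ J J′ e∈
                      x∈ , jp , jp′ = ∈-filter⁻ j? {xs = A} x∈J
                      x′∈ , jz , jz′ = ∈-filter⁻ j′? {xs = A} x′∈J′
                  in ∈-filter⁺ (λ σ → through? σ (p′ , z′))
                       (∈-filter⁺ (λ σ → represents? σ v)
                         (∈-cartesianProduct⁺ (∈-cartesianProduct⁺ (x⊕y∈S x∈ jp) (x⊕y∈S x∈ jp′))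
                                              (∈-cartesianProduct⁺ (x⊕y∈S x′∈ jz′) (x⊕y∈S x′∈ jz)))
                         (representation-represents (x , x′)))
                       (translate x _ _ , translate x′ _ _)

            -- Distinct good pairs own disjoint families of representations, each of size at least
            -- (T / τ)².
            fibre-large : length good * (T * T) ≤ τ * τ * length fibre
            fibre-large = fibre-lower through? fibre good (τ * τ) (T * T) (Uniq.filter⁺ good? A²-unique)
              (λ {σ} _ _ → through-functional {σ}) large
              where
              open ≤-Reasoning
              rearrange : ∀ τ c c′ → (τ * c) * (τ * c′) ≡ τ * τ * (c * c′)
              rearrange = solve-∀
              large : ∀ {e} → e ∈ good → T * T ≤ τ * τ * count (λ σ → through? σ e) fibre
              large {p′ , z′} e∈ = let _ , coincide , ¬l , ¬r = ∈-filter⁻ good? {xs = A²} e∈ in begin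
                T * T                                                                                  ≤⟨ *-mono-≤ (≮⇒≥ ¬l) (≮⇒≥ ¬r) ⟩
                (τ * codegree (a₀ ⊛ p) (a₀ ⊛ p′)) * (τ * codegree (a₀ ⊛ z) (a₀ ⊛ z′))                  ≡⟨ rearrange τ (codegree (a₀ ⊛ p) (a₀ ⊛ p′)) (codegree (a₀ ⊛ z) (a₀ ⊛ z′)) ⟩
                τ * τ * (codegree (a₀ ⊛ p) (a₀ ⊛ p′) * codegree (a₀ ⊛ z) (a₀ ⊛ z′))                    ≤⟨ *-monoʳ-≤ (τ * τ) (codegrees≤ coincide) ⟩
                τ * τ * count (λ σ → through? σ (p′ , z′)) fibre                                       ∎

        -- Each v in aP - bP owns at least (2k / w)(T / τ)² quadruples of S⁴, and distinct v own
        -- disjoint families because a₀ ≠ 0. For the final parameters the resulting bound is of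
        -- order u⁷s⁴ / n¹⁷, that is K¹⁸n.
        difference-bound : ∀ {a b} → a ∈ A → b ∈ A → 4 * k ≤ w * coincidences a b →
          length (differenceSet a b) * (2 * k * (T * T)) ≤ w * (τ * τ) * (s * s * (s * s))
        difference-bound {a} {b} a∈ b∈ h = ≤-trans
          (fibre-lower represents? S⁴ (differenceSet a b) (w * (τ * τ)) (2 * k * (T * T))
            (image₂-unique (λ p z → (a ⊛ p) ⊝ (b ⊛ z)) P P)
            (λ _ _ e e′ → ⊛-cancelˡ a₀ a₀≢0 (trans (sym e) e′)) large)
          (≤-reflexive (cong (w * (τ * τ) *_) length-S⁴))
          where
          open Representations a∈ b∈
          open ≤-Reasoning
          rearrange₁ : ∀ w g T → w * g * (T * T) ≡ w * (g * (T * T))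
          rearrange₁ = solve-∀
          fromPair : ∀ {p z} → p ∈ P → z ∈ P →
            2 * k * (T * T) ≤ w * (τ * τ) * count (λ σ → represents? σ ((a ⊛ p) ⊝ (b ⊛ z))) S⁴
          fromPair p∈ z∈ = begin
            2 * k * (T * T)                       ≤⟨ *-monoˡ-≤ (T * T) (good-many p∈ z∈ h) ⟩
            w * length (good p∈ z∈) * (T * T)     ≡⟨ rearrange₁ w (length (good p∈ z∈)) T ⟩
            w * (length (good p∈ z∈) * (T * T))   ≤⟨ *-monoʳ-≤ w (fibre-large p∈ z∈) ⟩
            w * (τ * τ * length (fibre p∈ z∈))    ≡⟨ *-assoc w (τ * τ) _ ⟨
            w * (τ * τ) * length (fibre p∈ z∈)    ∎
          large : ∀ {v} → v ∈ differenceSet a b → 2 * k * (T * T) ≤ w * (τ * τ) * count (λ σ → represents? σ v) S⁴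
          large v∈ = let p , z , p∈ , z∈ , eq = ∈-image₂⁻ (λ p z → (a ⊛ p) ⊝ (b ⊛ z)) P P v∈ in
            subst (λ v → 2 * k * (T * T) ≤ w * (τ * τ) * count (λ σ → represents? σ v) S⁴) (sym eq) (fromPair p∈ z∈)

        -- Cauchy-Schwarz for the multiplication P × A → AA; grouping the equal products az = bp by
        -- (b, a) turns the energy into a sum of coincidence counts.
        multiplicative-energy : length P * n * (length P * n) ≤ length Y * ∑ P (λ b → ∑ P (coincidences b))
        multiplicative-energy = begin
          length P * n * (length P * n)
            ≡⟨ cong₂ _*_ (length-cartesianProduct P A) (length-cartesianProduct P A) ⟨
          length PA * length PA
            ≤⟨ energy-lower _≟_ f (image₂-unique _⊛_ A A) (λ x∈ → let a∈ , z∈ = ∈-cartesianProduct⁻ P A x∈ in ∈-image₂⁺ _⊛_ (P⊆A a∈) z∈) ⟩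
          length Y * ∑ PA (λ x → count (λ x′ → f x′ ≟ f x) PA)
            ≡⟨ cong (length Y *_) (∑-× P A (λ x → count (λ x′ → f x′ ≟ f x) PA)) ⟩
          length Y * ∑ P (λ b → ∑ A (λ p → count (λ x′ → f x′ ≟ (b ⊛ p)) PA))
            ≡⟨ cong (length Y *_) (∑-cong P (λ b → ∑-cong A (λ p → count-× (λ x′ → f x′ ≟ (b ⊛ p)) P A))) ⟩
          length Y * ∑ P (λ b → ∑ A (λ p → ∑ P (λ a → count (λ z → (a ⊛ z) ≟ (b ⊛ p)) A)))
            ≡⟨ cong (length Y *_) (∑-cong P (λ b → ∑-swap A P (λ p a → count (λ z → (a ⊛ z) ≟ (b ⊛ p)) A))) ⟩
          length Y * ∑ P (λ b → ∑ P (λ a → ∑ A (λ p → count (λ z → (a ⊛ z) ≟ (b ⊛ p)) A)))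
            ≡⟨ cong (length Y *_) (∑-cong P (λ b → ∑-cong P (λ a → count-× (coincide? b a) A A))) ⟨
          length Y * ∑ P (λ b → ∑ P (coincidences b)) ∎
          where
          open ≤-Reasoning
          PA : List (F × F)
          PA = cartesianProduct P A
          f : F × F → F
          f (a , z) = a ⊛ z

        coincidences≤n : ∀ {a b} → b ∈ A → coincidences a b ≤ n
        coincidences≤n {a} {b} b∈ = length-≤-inj _≟_ proj₁ (Uniq.filter⁺ (coincide? a b) A²-unique)
          (λ e∈ e′∈ → proj₁-injective b∈ (proj₂ (unpack e∈)) (proj₂ (unpack e′∈)))
          (λ e∈ → proj₁ (∈-cartesianProduct⁻ A A (proj₁ (unpack e∈))))
          where
          unpack : ∀ {e} → e ∈ filter (coincide? a b) A² → e ∈ A² × Coincide a b e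
          unpack = ∈-filter⁻ (coincide? a b) {xs = A²}

        n≤coincidences : ∀ a → n ≤ coincidences a a
        n≤coincidences a = length-≤-inj _≟²_ (λ p → p , p) A-unique (λ _ _ → cong proj₁)
          (λ p∈ → ∈-filter⁺ (coincide? a a) (∈-cartesianProduct⁺ p∈ p∈) refl)

        popular-base : 1 ≤ length P → ∃ λ b → b ∈ P × length P * (n * n) ≤ length Y * ∑ P (coincidences b)
        popular-base P>0 = conclude (∃-above-average P (λ b → ∑ P (coincidences b)) P>0)
          where
          open ≤-Reasoning
          rearrange₁ : ∀ p n → p * (n * n) * p ≡ p * n * (p * n)
          rearrange₁ = solve-∀
          rearrange₂ : ∀ y p e → y * (p * e) ≡ y * e * p
          rearrange₂ = solve-∀
          conclude : (∃ λ b → b ∈ P × ∑ P (λ b → ∑ P (coincidences b)) ≤ length P * ∑ P (coincidences b)) →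
            ∃ λ b → b ∈ P × length P * (n * n) ≤ length Y * ∑ P (coincidences b)
          conclude (b , b∈ , h) = b , b∈ , *-cancelʳ-≤ _ _ (length P) ⦃ >-nonZero P>0 ⦄ (begin
            length P * (n * n) * length P                       ≡⟨ rearrange₁ (length P) n ⟩
            length P * n * (length P * n)                       ≤⟨ multiplicative-energy ⟩
            length Y * ∑ P (λ b → ∑ P (coincidences b))         ≤⟨ *-monoʳ-≤ (length Y) h ⟩
            length Y * (length P * ∑ P (coincidences b))        ≡⟨ rearrange₂ (length Y) (length P) (∑ P (coincidences b)) ⟩
            length Y * ∑ P (coincidences b) * length P          ∎)

        module Base {b : F} (b∈ : b ∈ P) where

          b≢0 : b ≢ 𝟘
          b≢0 = A≢𝟘 (P⊆A b∈)

          -- Precisely the condition under which `difference-bound` applies to bP - aP.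
          popular? : ∀ a → Dec (4 * k ≤ w * coincidences b a)
          popular? a = 4 * k ≤? w * coincidences b a

          P₁ : List F
          P₁ = filter popular? P

          P₁⊆P : P₁ ⊆ P
          P₁⊆P a∈ = proj₁ (∈-filter⁻ popular? {xs = P} a∈)

          P₁-unique : Unique P₁
          P₁-unique = Uniq.filter⁺ popular? P-unique

          popular-mass : w * ∑ P (coincidences b) ≤ length P₁ * (w * n) + length P * (4 * k)
          popular-mass = begin
            w * ∑ P (coincidences b)                                       ≡⟨ ∑-*ˡ P w (coincidences b) ⟨
            ∑ P (λ a → w * coincidences b a)                               ≡⟨ ∑-filter-split popular? P (λ a → w * coincidences b a) ⟨
            ∑ P₁ (λ a → w * coincidences b a) + ∑ P₂ (λ a → w * coincidences b a)
              ≤⟨ +-mono-≤ (∑-mono P₁ (λ a∈ → *-monoʳ-≤ w (coincidences≤n (P⊆A (P₁⊆P a∈)))))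
                          (∑-mono P₂ (λ a∈ → ≰⇒≥ (proj₂ (∈-filter⁻ (λ a → ¬? (popular? a)) {xs = P} a∈)))) ⟩
            ∑ P₁ (λ _ → w * n) + ∑ P₂ (λ _ → 4 * k)                        ≡⟨ cong₂ _+_ (∑-const P₁ (w * n)) (∑-const P₂ (4 * k)) ⟩
            length P₁ * (w * n) + length P₂ * (4 * k)                      ≤⟨ +-monoʳ-≤ (length P₁ * (w * n)) (*-monoˡ-≤ (4 * k) (length-filter (λ a → ¬? (popular? a)) P)) ⟩
            length P₁ * (w * n) + length P * (4 * k)                       ∎
            where
            open ≤-Reasoning
            P₂ : List F
            P₂ = filter (λ a → ¬? (popular? a)) P

          X W : ℕ
          X = 2 * k * (T * T)
          W = w * (τ * τ) * (s * s * (s * s))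

          -- The case of two equal multipliers, where bA ∩ bA has n elements; the dilation by b is
          -- then undone.
          differences-bound : 4 * k ≤ w * n → length (image₂ _⊝_ P₁ P₁) * X ≤ W
          differences-bound h = ≤-trans (*-monoˡ-≤ X scaled)
            (difference-bound (P⊆A b∈) (P⊆A b∈) (≤-trans h (*-monoʳ-≤ w (n≤coincidences b))))
            where
            into : ∀ {v} → v ∈ image₂ _⊝_ P₁ P₁ → b ⊛ v ∈ differenceSet b b
            into v∈ with ∈-image₂⁻ _⊝_ P₁ P₁ v∈
            ... | p , q , p∈ , q∈ , refl = subst (_∈ differenceSet b b)
              (solve 3 (λ b p q → b :* p :- b :* q := b :* (p :- q)) refl b p q)
              (∈-image₂⁺ (λ p z → (b ⊛ p) ⊝ (b ⊛ z)) (P₁⊆P p∈) (P₁⊆P q∈))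
            scaled : length (image₂ _⊝_ P₁ P₁) ≤ length (differenceSet b b)
            scaled = length-≤-inj _≟_ (b ⊛_) (image₂-unique _⊝_ P₁ P₁) (λ _ _ → ⊛-cancelˡ b b≢0) into

          -- With bP as the common set, each Z - xP₁ lies in bP - xP for an x that is popular
          -- against b.
          Z : List F
          Z = map (b ⊛_) P

          translates-bound : ∀ {x} → x ∈ P₁ → length (image₂ (λ z q → z ⊝ (x ⊛ q)) Z P₁) * X ≤ W
          translates-bound {x} x∈ = ≤-trans (*-monoˡ-≤ X (length-≤-⊆ _≟_ (image₂-unique (λ z q → z ⊝ (x ⊛ q)) Z P₁) into))
            (difference-bound (P⊆A b∈) (P⊆A (P₁⊆P x∈)) (proj₂ (∈-filter⁻ popular? {xs = P} x∈)))
            where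
            into : image₂ (λ z q → z ⊝ (x ⊛ q)) Z P₁ ⊆ differenceSet b x
            into e∈ with ∈-image₂⁻ (λ z q → z ⊝ (x ⊛ q)) Z P₁ e∈
            ... | _ , q , z∈ , q∈ , refl with ∈-map⁻ (b ⊛_) z∈
            ...   | p , p∈ , refl = ∈-image₂⁺ (λ p z → (b ⊛ p) ⊝ (x ⊛ z)) p∈ (P₁⊆P q∈)

          dilateSum-P₁-bound : 1 ≤ length P₁ → ∀ {a b c d} → a ∈ P₁ → b ∈ P₁ → c ∈ P₁ → d ∈ P₁ →
            length (dilateSum (c ⊝ d) (a ⊝ b) P₁) * (length P ^ 3 * X ^ 4) ≤ 16 * (4 * W) ^ 4
          dilateSum-P₁-bound P₁>0 {a} {b′} {c} {d} a∈ b′∈ c∈ d∈ =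
            subst (λ z → length (dilateSum (c ⊝ d) (a ⊝ b′) P₁) * (z ^ 3 * X ^ 4) ≤ 16 * (4 * W) ^ 4) (length-map (b ⊛_) P)
              (dilateSum-bound Z P₁ (Uniq.map⁺ (⊛-cancelˡ b b≢0) P-unique)
                (≤-trans (∈-length b∈) (≤-reflexive (sym (length-map (b ⊛_) P)))) P₁>0 X W
                λ { (here refl) → translates-bound a∈
                  ; (there (here refl)) → translates-bound b′∈
                  ; (there (there (here refl))) → translates-bound c∈
                  ; (there (there (there (here refl)))) → translates-bound d∈ })

    -- Markov's inequality against the rare total: X ≤ 8u · y²n⁷ / (16u³ · n · n³) = y²n³ / (2u²),
    -- and yn ≤ u makes this at most n / 2. For this the 16 in τ is twice the 8 in w.
    core-numbers : ∀ X β B y → X * (n * n * n) ≤ 8 * u * β → n * β ≤ B → 16 * (u * u * u) * B ≤ y * y * n ^ 7 →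
      y * n ≤ u → 2 * X ≤ n
    core-numbers X β B y h₁ h₂ h₃ h₄ = *-cancelʳ-≤ _ _ (8 * (u * u * u) * (n * n * n * (n * n * n))) ⦃ nonzero ⦄ (begin
      2 * X * (8 * (u * u * u) * (n * n * n * (n * n * n)))      ≡⟨ e₁ X u n ⟩
      16 * (u * u * u) * (n * n * n) * (X * (n * n * n))         ≤⟨ *-monoʳ-≤ (16 * (u * u * u) * (n * n * n)) h₁ ⟩
      16 * (u * u * u) * (n * n * n) * (8 * u * β)               ≡⟨ e₂ u n β ⟩
      8 * u * (n * n) * (16 * (u * u * u) * (n * β))             ≤⟨ *-monoʳ-≤ (8 * u * (n * n)) (≤-trans (*-monoʳ-≤ (16 * (u * u * u)) h₂) h₃) ⟩
      8 * u * (n * n) * (y * y * n ^ 7)                          ≡⟨ e₃ u n y (n ^ 7) ⟩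
      8 * u * (y * n * (y * n)) * n ^ 7                          ≤⟨ *-monoˡ-≤ (n ^ 7) (*-monoʳ-≤ (8 * u) (*-mono-≤ h₄ h₄)) ⟩
      8 * u * (u * u) * n ^ 7                                    ≡⟨ e₄ u n ⟩
      n * (8 * (u * u * u) * (n * n * n * (n * n * n)))          ∎)
      where
      open ≤-Reasoning
      nonzero : NonZero (8 * (u * u * u) * (n * n * n * (n * n * n)))
      nonzero = >-nonZero (*-mono-≤ {1} (*-mono-≤ {1} {8} (s≤s z≤n) (*-mono-≤ (*-mono-≤ u>0 u>0) u>0))
                  (*-mono-≤ (*-mono-≤ (*-mono-≤ A>0 A>0) A>0) (*-mono-≤ (*-mono-≤ A>0 A>0) A>0)))
      e₁ : ∀ X u n → 2 * X * (8 * (u * u * u) * (n * n * n * (n * n * n))) ≡ 16 * (u * u * u) * (n * n * n) * (X * (n * n * n))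
      e₁ = solve-∀
      e₂ : ∀ u n β → 16 * (u * u * u) * (n * n * n) * (8 * u * β) ≡ 8 * u * (n * n) * (16 * (u * u * u) * (n * β))
      e₂ = solve-∀
      e₃ : ∀ u n y t → 8 * u * (n * n) * (y * y * t) ≡ 8 * u * (y * n * (y * n)) * t
      e₃ = solve-∀
      e₄ : ∀ u n → 8 * u * (u * u) * (n * (n * (n * (n * (n * (n * (n * 1))))))) ≡ n * (8 * (u * u * u) * (n * n * n * (n * n * n)))
      e₄ = solve-∀

    -- The popularity threshold 4n³ / (8u) = n³ / (2u) is half of n³ / u, which the average E / p
    -- attains. So the popular elements carry at least half of E, and each of them carries at most
    -- n.
    popular-numbers : ∀ p m y E → p * (n * n) ≤ y * E → 8 * u * E ≤ m * (8 * u * n) + p * (4 * (n * n * n)) →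
      y * n ≤ u → n ≤ 2 * p → n * n * n ≤ 4 * u * m
    popular-numbers p m y E h₁ h₂ h₃ h₄ = begin
      n * n * n          ≡⟨ *-assoc n n n ⟩
      n * (n * n)        ≤⟨ *-monoˡ-≤ (n * n) h₄ ⟩
      2 * p * (n * n)    ≤⟨ *-cancelʳ-≤ _ _ (2 * n) ⦃ >-nonZero (*-mono-≤ {1} {2} (s≤s z≤n) A>0) ⦄ core ⟩
      4 * u * m          ∎
      where
      open ≤-Reasoning
      e₁ : ∀ p n → 2 * p * (n * n) * (2 * n) + p * (4 * (n * n * n)) ≡ 8 * n * (p * (n * n))
      e₁ = solve-∀
      e₂ : ∀ n y E → 8 * n * (y * E) ≡ 8 * (y * n) * E
      e₂ = solve-∀
      e₃ : ∀ m u n x → m * (8 * u * n) + x ≡ 4 * u * m * (2 * n) + x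
      e₃ = solve-∀
      core : 2 * p * (n * n) * (2 * n) ≤ 4 * u * m * (2 * n)
      core = +-cancelʳ-≤ (p * (4 * (n * n * n))) _ _ (begin
        2 * p * (n * n) * (2 * n) + p * (4 * (n * n * n))   ≡⟨ e₁ p n ⟩
        8 * n * (p * (n * n))                               ≤⟨ *-monoʳ-≤ (8 * n) h₁ ⟩
        8 * n * (y * E)                                     ≡⟨ e₂ n y E ⟩
        8 * (y * n) * E                                     ≤⟨ *-monoˡ-≤ E (*-monoʳ-≤ 8 h₃) ⟩
        8 * u * E                                           ≤⟨ h₂ ⟩
        m * (8 * u * n) + p * (4 * (n * n * n))             ≡⟨ e₃ m u n (p * (4 * (n * n * n))) ⟩
        4 * u * m * (2 * n) + p * (4 * (n * n * n))         ∎)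

    X-power : 2 * (n * n * n) * (n ^ 7 * n ^ 7) ≡ 2 * n ^ 17
    X-power = trans (cong₂ (λ a b → 2 * a * b) (cube n) (sym (^-distribˡ-+-* n 7 7)))
      (trans (*-assoc 2 (n ^ 3) (n ^ 14)) (cong (2 *_) (sym (^-distribˡ-+-* n 3 14))))
      where
      cube : ∀ n → n * n * n ≡ n * (n * (n * 1))
      cube = solve-∀

    W-power : 8 * u * (16 * (u * u * u) * (16 * (u * u * u))) * (s * s * (s * s)) ≡ 2 ^ 11 * (u ^ 7 * s ^ 4)
    W-power = trans (gather 8 16 u s) (cong (_* (u ^ 7 * s ^ 4)) constant)
      where
      gather : ∀ e f u s → e * u * (f * (u * u * u) * (f * (u * u * u))) * (s * s * (s * s))
        ≡ e * (f * f) * ((u * (u * (u * (u * (u * (u * (u * 1))))))) * (s * (s * (s * (s * 1)))))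
      gather = solve-∀
      constant : 8 * (16 * 16) ≡ 2 ^ 11
      constant = refl

    -- Choice of thresholds and assembly over a finite domain

    module _ (elements : List F) (elements-unique : Unique elements) (complete : ∀ x → x ∈ elements)
      (descent : (T : F → Set) → T 𝟘 → (∀ x → T x → T (x ⊝ 𝟏)) → ∀ x → T x)
      (A-small : n * n ≤ length elements) where

      open Popular (16 * (u * u * u)) (n ^ 7)

      module AtCentre {a₀ : F} (a₀∈ : a₀ ∈ A) (h₀ : n * ∑ A (rareDegree a₀) ≤ ∑ A (λ a → ∑ A (rareDegree a))) where

        open Centre a₀∈ (8 * u) (n * n * n)

        n≤2P : n ≤ 2 * length P
        n≤2P = +-cancelʳ-≤ (2 * excluded) _ _ (begin
          n + 2 * excluded               ≤⟨ +-monoʳ-≤ n 2excluded≤n ⟩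
          n + n                         ≡⟨ cong (n +_) (+-identityʳ n) ⟨
          2 * n                         ≡⟨ cong (2 *_) (count-split core? A) ⟨
          2 * (length P + excluded)      ≡⟨ *-distribˡ-+ 2 (length P) excluded ⟩
          2 * length P + 2 * excluded    ∎)
          where
          open ≤-Reasoning
          excluded : ℕ
          excluded = count (λ p → ¬? (core? p)) A
          2excluded≤n : 2 * excluded ≤ n
          2excluded≤n = core-numbers excluded (∑ A (rareDegree a₀)) (∑ A (λ a → ∑ A (rareDegree a))) (length Y)
            (≤-trans (markov A (λ p → 8 * u * rareDegree a₀ p) (n * n * n)) (≤-reflexive (∑-*ˡ A (8 * u) (rareDegree a₀))))
            h₀ rare-total product-set-bound

        P>0 : 1 ≤ length P
        P>0 = n≢0⇒n>0 λ P≡0 → <-irrefl refl (≤-trans A>0 (≤-trans n≤2P (≤-reflexive (cong (2 *_) P≡0))))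

        module AtBase {b : F} (b∈ : b ∈ P) (h₁ : length P * (n * n) ≤ length Y * ∑ P (coincidences b)) where

          open Base b∈

          P₁-large : n * n * n ≤ 4 * u * length P₁
          P₁-large = popular-numbers (length P) (length P₁) (length Y) (∑ P (coincidences b)) h₁ popular-mass product-set-bound n≤2P

          P₁>0 : 1 ≤ length P₁
          P₁>0 = n≢0⇒n>0 λ P₁≡0 → <-irrefl refl (≤-trans (*-mono-≤ (*-mono-≤ A>0 A>0) A>0)
            (≤-trans P₁-large (≤-reflexive (trans (cong (4 * u *_) P₁≡0) (*-zeroʳ (4 * u))))))

          P₁≤n : length P₁ ≤ n
          P₁≤n = length-≤-⊆ _≟_ P₁-unique (λ a∈ → P⊆A (P₁⊆P a∈))

          open Pivot elements elements-unique complete descent P₁ P₁-unique P₁>0 (≤-trans (*-mono-≤ P₁≤n P₁≤n) A-small)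
            using (Expands; pivot)

          4k≤wn : 4 * (n * n * n) ≤ 8 * u * n
          4k≤wn = begin
            4 * (n * n * n)      ≡⟨ *-assoc 4 (n * n) n ⟨
            4 * (n * n) * n      ≤⟨ *-monoˡ-≤ n (*-mono-≤ {4} {8} (s≤s (s≤s (s≤s (s≤s z≤n)))) n²≤u) ⟩
            8 * u * n            ∎
            where open ≤-Reasoning

          conclude : Expands → n ^ 97 ≤ 2 ^ 154 * s ^ 96
          conclude (a , b′ , c , d , a∈ , b′∈ , c∈ , d∈ , h) = collect-powers 2 n s u X W
            (cong (λ t → 4 * (s * t)) (sym (*-identityʳ s))) X-power W-power (s≤s z≤n)
            (pivot-numbers 2 n u (length P₁) (length P) (length (image₂ _⊝_ P₁ P₁)) (length (dilateSum (c ⊝ d) (a ⊝ b′) P₁)) X W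
              h (differences-bound 4k≤wn) (dilateSum-P₁-bound P₁>0 a∈ b′∈ c∈ d∈) P₁-large n≤2P)

          growth : n ^ 97 ≤ 2 ^ 154 * s ^ 96
          growth = conclude pivot

        growth : n ^ 97 ≤ 2 ^ 154 * s ^ 96
        growth = let _ , b∈ , h₁ = popular-base P>0 in AtBase.growth b∈ h₁

      shifted-product-growth : n ^ 97 ≤ 2 ^ 154 * s ^ 96
      shifted-product-growth = let _ , a₀∈ , h₀ = ∃-below-average A (λ a → ∑ A (rareDegree a)) A>0 in AtCentre.growth a₀∈ h₀

-- The prime field and subsets of it

module PrimeField {p : ℕ} (pr : Prime p) where

  private instance
    p≢0 : NonZero p
    p≢0 = prime⇒nonZero pr

  residue : ℕ → Fin p
  residue n = n mod p

  toℕ-residue : ∀ n → toℕ (residue n) ≡ n % p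
  toℕ-residue n = toℕ-fromℕ< _

  residue-cong : ∀ {m n} → m % p ≡ n % p → residue m ≡ residue n
  residue-cong {m} {n} h = toℕ-injective (trans (toℕ-residue m) (trans h (sym (toℕ-residue n))))

  residue-toℕ : ∀ x → residue (toℕ x) ≡ x
  residue-toℕ x = toℕ-injective (trans (toℕ-residue (toℕ x)) (m<n⇒m%n≡m (toℕ<n x)))

  0%p≡0 : 0 % p ≡ 0
  0%p≡0 = n∣m⇒m%n≡0 0 p (p ∣0)

  residue-+ˡ : ∀ m n → residue (toℕ (residue m) + n) ≡ residue (m + n)
  residue-+ˡ m n = residue-cong (trans (cong (λ r → (r + n) % p) (toℕ-residue m))
    (trans (%-distribˡ-+ (m % p) n p) (trans (cong (λ r → (r + n % p) % p) (m%n%n≡m%n m p)) (sym (%-distribˡ-+ m n p)))))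

  residue-+ʳ : ∀ m n → residue (m + toℕ (residue n)) ≡ residue (m + n)
  residue-+ʳ m n = trans (cong residue (+-comm m _)) (trans (residue-+ˡ n m) (cong residue (+-comm n m)))

  residue-*ˡ : ∀ m n → residue (toℕ (residue m) * n) ≡ residue (m * n)
  residue-*ˡ m n = residue-cong (trans (cong (λ r → (r * n) % p) (toℕ-residue m))
    (trans (%-distribˡ-* (m % p) n p) (trans (cong (λ r → (r * (n % p)) % p) (m%n%n≡m%n m p)) (sym (%-distribˡ-* m n p)))))

  residue-*ʳ : ∀ m n → residue (m * toℕ (residue n)) ≡ residue (m * n)
  residue-*ʳ m n = trans (cong residue (*-comm m _)) (trans (residue-*ˡ n m) (cong residue (*-comm n m)))

  infixl 6 _⊕_
  infixl 7 _⊛_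
  _⊕_ _⊛_ : Fin p → Fin p → Fin p
  x ⊕ y = residue (toℕ x + toℕ y)
  _⊛_ = mulF pr

  ⊖_ : Fin p → Fin p
  ⊖ x = residue (p ∸ toℕ x)

  𝟘 𝟏 : Fin p
  𝟘 = residue 0
  𝟏 = residue 1

  ⊕-comm : ∀ x y → x ⊕ y ≡ y ⊕ x
  ⊕-comm x y = cong residue (+-comm (toℕ x) (toℕ y))

  ⊛-comm : ∀ x y → x ⊛ y ≡ y ⊛ x
  ⊛-comm x y = cong residue (*-comm (toℕ x) (toℕ y))

  ⊕-assoc : ∀ x y z → (x ⊕ y) ⊕ z ≡ x ⊕ (y ⊕ z)
  ⊕-assoc x y z = trans (residue-+ˡ (toℕ x + toℕ y) (toℕ z))
    (trans (cong residue (+-assoc (toℕ x) (toℕ y) (toℕ z))) (sym (residue-+ʳ (toℕ x) (toℕ y + toℕ z))))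

  ⊛-assoc : ∀ x y z → (x ⊛ y) ⊛ z ≡ x ⊛ (y ⊛ z)
  ⊛-assoc x y z = trans (residue-*ˡ (toℕ x * toℕ y) (toℕ z))
    (trans (cong residue (*-assoc (toℕ x) (toℕ y) (toℕ z))) (sym (residue-*ʳ (toℕ x) (toℕ y * toℕ z))))

  ⊕-identityˡ : ∀ x → 𝟘 ⊕ x ≡ x
  ⊕-identityˡ x = trans (residue-+ˡ 0 (toℕ x)) (residue-toℕ x)

  ⊛-identityˡ : ∀ x → 𝟏 ⊛ x ≡ x
  ⊛-identityˡ x = trans (residue-*ˡ 1 (toℕ x)) (trans (cong residue (*-identityˡ (toℕ x))) (residue-toℕ x))

  ⊖-inverseˡ : ∀ x → (⊖ x) ⊕ x ≡ 𝟘
  ⊖-inverseˡ x = trans (residue-+ˡ (p ∸ toℕ x) (toℕ x))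
    (trans (cong residue (m∸n+n≡m (<⇒≤ (toℕ<n x)))) (residue-cong (trans (n%n≡0 p) (sym 0%p≡0))))

  ⊛-distribˡ-⊕ : ∀ x y z → x ⊛ (y ⊕ z) ≡ (x ⊛ y) ⊕ (x ⊛ z)
  ⊛-distribˡ-⊕ x y z = trans (residue-*ʳ (toℕ x) (toℕ y + toℕ z))
    (trans (cong residue (*-distribˡ-+ (toℕ x) (toℕ y) (toℕ z)))
      (sym (trans (residue-+ˡ (toℕ x * toℕ y) _) (residue-+ʳ (toℕ x * toℕ y) (toℕ x * toℕ z)))))

  isCommutativeRing : IsCommutativeRing _≡_ _⊕_ _⊛_ ⊖_ 𝟘 𝟏
  isCommutativeRing = record
    { isRing = record
      { +-isAbelianGroup = record
        { isGroup = record
          { isMonoid = record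
            { isSemigroup = record
              { isMagma = record { isEquivalence = isEquivalence ; ∙-cong = cong₂ _⊕_ }
              ; assoc = ⊕-assoc
              }
            ; identity = ⊕-identityˡ , λ x → trans (⊕-comm x 𝟘) (⊕-identityˡ x)
            }
          ; inverse = ⊖-inverseˡ , λ x → trans (⊕-comm x (⊖ x)) (⊖-inverseˡ x)
          ; ⁻¹-cong = cong ⊖_
          }
        ; comm = ⊕-comm
        }
      ; *-cong = cong₂ _⊛_
      ; *-assoc = ⊛-assoc
      ; *-identity = ⊛-identityˡ , λ x → trans (⊛-comm x 𝟏) (⊛-identityˡ x)
      ; distrib = ⊛-distribˡ-⊕ , λ x y z → trans (⊛-comm (y ⊕ z) x)
          (trans (⊛-distribˡ-⊕ x y z) (cong₂ _⊕_ (⊛-comm x y) (⊛-comm x z)))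
      }
    ; *-comm = ⊛-comm
    }

  noZeroDivisors : ∀ x y → x ⊛ y ≡ 𝟘 → x ≡ 𝟘 ⊎ y ≡ 𝟘
  noZeroDivisors x y h = map⊎ (vanish x) (vanish y) (euclidsLemma (toℕ x) (toℕ y) pr (m%n≡0⇒n∣m _ p
    (trans (sym (toℕ-residue _)) (trans (cong toℕ h) (trans (toℕ-residue 0) 0%p≡0)))))
    where
    vanish : ∀ z → p divides toℕ z → z ≡ 𝟘
    vanish z p∣z = trans (sym (residue-toℕ z)) (residue-cong (trans (n∣m⇒m%n≡0 (toℕ z) p p∣z) (sym 0%p≡0)))

  open Domain (Fin p) _≟ᶠ_ _⊕_ _⊛_ ⊖_ 𝟘 𝟏 isCommutativeRing noZeroDivisors using (_⊝_; commutativeRing)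
  open IntegerCoefficientSolver commutativeRing using (solve; :-_; _:+_; _:-_; _:=_)

  -- Every x is -k for some natural k, hence is reached from 0 by k subtractions of 1.
  descent : (T : Fin p → Set) → T 𝟘 → (∀ x → T x → T (x ⊝ 𝟏)) → ∀ x → T x
  descent T T𝟘 step x = subst T
    (trans (cong ⊖_ (residue-toℕ (⊖ x))) (solve 1 (λ x → :- (:- x) := x) refl x))
    (negatives (toℕ (⊖ x)))
    where
    negatives : ∀ k → T (⊖ residue k)
    negatives zero    = subst T (trans (sym (⊖-inverseˡ 𝟘)) (trans (⊕-comm (⊖ 𝟘) 𝟘) (⊕-identityˡ (⊖ 𝟘)))) T𝟘
    negatives (suc k) = subst T
      (trans (solve 2 (λ r o → :- r :- o := :- (o :+ r)) refl (residue k) 𝟏)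
             (cong ⊖_ (trans (residue-+ʳ (toℕ 𝟏) k) (residue-+ˡ 1 k))))
      (step _ (negatives k))

  ⊕𝟏≡succF : ∀ x → x ⊕ 𝟏 ≡ succF pr x
  ⊕𝟏≡succF x = residue-+ʳ (toℕ x) 1

elements : ∀ {n} → Subset n → List (Fin n)
elements []            = []
elements (inside ∷ A)  = zero ∷ map suc (elements A)
elements (outside ∷ A) = map suc (elements A)

length-elements : ∀ {n} (A : Subset n) → length (elements A) ≡ ∣ A ∣
length-elements []            = refl
length-elements (inside ∷ A)  = cong suc (trans (length-map suc (elements A)) (length-elements A))
length-elements (outside ∷ A) = trans (length-map suc (elements A)) (length-elements A)

elements-unique : ∀ {n} (A : Subset n) → Unique (elements A)
elements-unique []            = []
elements-unique (inside ∷ A)  = All-tabulate zero∉ ∷ Uniq.map⁺ sucᶠ-injective (elements-unique A)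
  where
  zero∉ : ∀ {i} → i ∈ map suc (elements A) → zero ≢ i
  zero∉ i∈ refl with ∈-map⁻ suc i∈
  ... | _ , _ , ()
elements-unique (outside ∷ A) = Uniq.map⁺ sucᶠ-injective (elements-unique A)

∈-elements⁺ : ∀ {n} {A : Subset n} {i} → i ∈ₛ A → i ∈ elements A
∈-elements⁺ {A = inside ∷ A}  here       = here refl
∈-elements⁺ {A = inside ∷ A}  (there i∈) = there (∈-map⁺ suc (∈-elements⁺ i∈))
∈-elements⁺ {A = outside ∷ A} (there i∈) = ∈-map⁺ suc (∈-elements⁺ i∈)

∈-elements⁻ : ∀ {n} (A : Subset n) {i} → i ∈ elements A → i ∈ₛ A
∈-elements⁻ (inside ∷ A)  (here refl) = here
∈-elements⁻ (inside ∷ A)  (there i∈) with ∈-map⁻ suc i∈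
... | _ , j∈ , refl = there (∈-elements⁻ A j∈)
∈-elements⁻ (outside ∷ A) i∈ with ∈-map⁻ suc i∈
... | _ , j∈ , refl = there (∈-elements⁻ A j∈)

∈-prodShift⁺ : ∀ {p} (pr : Prime p) {A : Subset p} {x} → InProdShift pr A x → x ∈ₛ prodShift pr A
∈-prodShift⁺ pr {A} {x} witness = lookup⇒[]= x (prodShift pr A)
  (trans (lookup∘tabulate _ x)
    (dec-true (anyᶠ? λ a → anyᶠ? λ b → (a ∈ₛ? A) ×-dec ((b ∈ₛ? A) ×-dec (x ≟ᶠ mulF pr a (succF pr b)))) witness))

-- Restoring the removed elements at most doubles the set, which costs 2⁹⁷; hence the exponent 251 =
-- 97 + 154.
rescale : ∀ t N n s s′ → N ≤ t * n → n ^ 97 ≤ t ^ 154 * s ^ 96 → s ≤ s′ → N ^ 97 ≤ t ^ 251 * s′ ^ 96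
rescale t N n s s′ h₁ h₂ h₃ = begin
  N ^ 97                          ≤⟨ ^-monoˡ-≤ 97 h₁ ⟩
  (t * n) ^ 97                    ≡⟨ ^-distribʳ-* 97 t n ⟩
  t ^ 97 * n ^ 97                 ≤⟨ *-monoʳ-≤ (t ^ 97) (≤-trans h₂ (*-monoʳ-≤ (t ^ 154) (^-monoˡ-≤ 96 h₃))) ⟩
  t ^ 97 * (t ^ 154 * s′ ^ 96)    ≡⟨ *-assoc (t ^ 97) (t ^ 154) (s′ ^ 96) ⟨
  t ^ 97 * t ^ 154 * s′ ^ 96      ≡⟨ cong (_* s′ ^ 96) (^-distribˡ-+-* t 97 154) ⟨
  t ^ 251 * s′ ^ 96               ∎
  where open ≤-Reasoning

-- Removal of 0 and -1 from a subset of the prime field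

module _ {p : ℕ} (pr : Prime p) (A : Subset p) (A≥4 : 4 ≤ ∣ A ∣) (A-small : ∣ A ∣ * ∣ A ∣ < p) where

  open PrimeField pr

  admissible? : ∀ a → Dec (a ≢ 𝟘 × a ⊕ 𝟏 ≢ 𝟘)
  admissible? a = ¬? (a ≟ᶠ 𝟘) ×-dec ¬? ((a ⊕ 𝟏) ≟ᶠ 𝟘)

  A₀ : List (Fin p)
  A₀ = filter admissible? (elements A)

  A₀-unique : Unique A₀
  A₀-unique = Uniq.filter⁺ admissible? (elements-unique A)

  open Domain (Fin p) _≟ᶠ_ _⊕_ _⊛_ ⊖_ 𝟘 𝟏 isCommutativeRing noZeroDivisors using (⊕-cancelʳ; module Shift)

  ∣A∣≤A₀+2 : ∣ A ∣ ≤ length A₀ + 2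
  ∣A∣≤A₀+2 = begin
    ∣ A ∣                                               ≡⟨ length-elements A ⟨
    length (elements A)                                 ≡⟨ count-split admissible? (elements A) ⟨
    length A₀ + count (¬? ∘ admissible?) (elements A)   ≤⟨ +-monoʳ-≤ (length A₀) exceptions ⟩
    length A₀ + 2                                       ∎
    where
    open ≤-Reasoning
    exceptions : count (¬? ∘ admissible?) (elements A) ≤ 2
    exceptions = ≤-trans
      (count-⊎ (¬? ∘ admissible?) (_≟ᶠ 𝟘) (λ a → (a ⊕ 𝟏) ≟ᶠ 𝟘) (elements A)
        (λ {a} _ ¬ok a≢𝟘 → decidable-stable ((a ⊕ 𝟏) ≟ᶠ 𝟘) (λ a+𝟏≢𝟘 → ¬ok (a≢𝟘 , a+𝟏≢𝟘))))
      (+-mono-≤ (count-≤1 (_≟ᶠ 𝟘) (elements-unique A) (λ _ _ h k → trans h (sym k)))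
                (count-≤1 (λ a → (a ⊕ 𝟏) ≟ᶠ 𝟘) (elements-unique A) (λ _ _ h k → ⊕-cancelʳ 𝟏 (trans h (sym k)))))

  -- Losing two elements costs at most half of a set of size at least 4.
  ∣A∣≤2A₀ : ∣ A ∣ ≤ 2 * length A₀
  ∣A∣≤2A₀ = +-cancelʳ-≤ 4 _ _ (begin
    ∣ A ∣ + 4                  ≤⟨ +-monoʳ-≤ (∣ A ∣) A≥4 ⟩
    ∣ A ∣ + ∣ A ∣              ≤⟨ +-mono-≤ ∣A∣≤A₀+2 ∣A∣≤A₀+2 ⟩
    length A₀ + 2 + (length A₀ + 2)  ≡⟨ double (length A₀) ⟩
    2 * length A₀ + 4          ∎)
    where
    open ≤-Reasoning
    double : ∀ k → k + 2 + (k + 2) ≡ 2 * k + 4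
    double = solve-∀

  A₀>0 : 1 ≤ length A₀
  A₀>0 = n≢0⇒n>0 λ A₀≡0 → <-irrefl refl (≤-trans (≤-trans (s≤s z≤n) A≥4) (≤-trans ∣A∣≤2A₀ (≤-reflexive (cong (2 *_) A₀≡0))))

  admissible : ∀ {a} → a ∈ A₀ → a ∈ elements A × a ≢ 𝟘 × a ⊕ 𝟏 ≢ 𝟘
  admissible = ∈-filter⁻ admissible? {xs = elements A}

  open Shift A₀ A₀-unique A₀>0 (λ a∈ → proj₁ (proj₂ (admissible a∈))) (λ a∈ → proj₂ (proj₂ (admissible a∈)))
    using (S; n; s; shifted-product-growth)
  open Image (_≟ᶠ_ {p})

  n≤∣A∣ : n ≤ ∣ A ∣
  n≤∣A∣ = ≤-trans (length-≤-⊆ _≟ᶠ_ A₀-unique (λ a∈ → proj₁ (admissible a∈))) (≤-reflexive (length-elements A))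

  s≤∣prodShift∣ : s ≤ ∣ prodShift pr A ∣
  s≤∣prodShift∣ = ≤-trans (length-≤-⊆ _≟ᶠ_ (image₂-unique (λ a b → a ⊛ (b ⊕ 𝟏)) A₀ A₀) into) (≤-reflexive (length-elements (prodShift pr A)))
    where
    into : ∀ {x} → x ∈ S → x ∈ elements (prodShift pr A)
    into x∈ = let a , b , a∈ , b∈ , eq = ∈-image₂⁻ (λ a b → a ⊛ (b ⊕ 𝟏)) A₀ A₀ x∈ in
      ∈-elements⁺ (∈-prodShift⁺ pr (a , b , ∈-elements⁻ A (proj₁ (admissible a∈)) , ∈-elements⁻ A (proj₁ (admissible b∈)) ,
        trans eq (cong (mulF pr a) (⊕𝟏≡succF b))))

  prodShift-growth : ∣ A ∣ ^ 97 ≤ 2 ^ 251 * ∣ prodShift pr A ∣ ^ 96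
  prodShift-growth = rescale 2 (∣ A ∣) n s (∣ prodShift pr A ∣) ∣A∣≤2A₀
    (shifted-product-growth (allFin p) (Uniq.allFin⁺ p) ∈-allFin descent
      (≤-trans (*-mono-≤ n≤∣A∣ n≤∣A∣) (≤-trans (<⇒≤ A-small) (≤-reflexive (sym (length-tabulate {n = p} (λ i → i)))))))
    s≤∣prodShift∣

theorem1 : (m : ℕ) → ∃[ N ] ((p : ℕ) (pr : Prime p) (A : Subset p) →
    Nonempty A → N ≤ ∣ A ∣ → ∣ A ∣ * ∣ A ∣ < p →
    ∣ A ∣ ^ (106 * suc m ∸ 105) ≤ ∣ prodShift pr A ∣ ^ (105 * suc m))
-- Since 97·105 = 106·96 + 9 and 12·9 = 108 ≥ 106, sets of size at least (2^251)^12 absorb the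
-- constant 2^251, giving |A|^106 ≤ |A(A+1)|^105. The goal for `m` asks for the exponent 106/105 -
-- 1/(m + 1), with denominators cleared; the threshold is chosen before p, which is the uniformity
-- of o(1).
theorem1 m = (2 ^ 251) ^ 12 , λ p pr A A≠∅ A-large A-small →
  conclude (∣ A ∣) (∣ prodShift pr A ∣) (≤-trans threshold A-large)
    (exponent-comparison 97 96 106 105 9 12 (2 ^ 251) (∣ A ∣) (∣ prodShift pr A ∣) refl (m≤m+n 106 2) C≥2 A-large
      (prodShift-growth pr A (≤-trans threshold A-large) A-small))
  where
  C≥2 : 2 ≤ 2 ^ 251
  C≥2 = ^-monoʳ-≤ 2 {1} {251} (s≤s z≤n)
  threshold : 4 ≤ (2 ^ 251) ^ 12
  threshold = ≤-trans (^-monoʳ-≤ 2 {2} {251} (s≤s (s≤s z≤n)))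
    (≤-trans (≤-reflexive (sym (*-identityʳ (2 ^ 251)))) (^-monoʳ-≤ (2 ^ 251) ⦃ m^n≢0 2 251 ⦄ {1} {12} (s≤s z≤n)))
  conclude : ∀ N s → 4 ≤ N → N ^ 106 ≤ s ^ 105 → N ^ (106 * suc m ∸ 105) ≤ s ^ (105 * suc m)
  conclude N s N≥4 h = begin
    N ^ (106 * suc m ∸ 105)   ≤⟨ ^-monoʳ-≤ N ⦃ >-nonZero (≤-trans (s≤s z≤n) N≥4) ⦄ (m∸n≤m (106 * suc m) 105) ⟩
    N ^ (106 * suc m)         ≡⟨ ^-*-assoc N 106 (suc m) ⟨
    (N ^ 106) ^ suc m         ≤⟨ ^-monoˡ-≤ (suc m) h ⟩
    (s ^ 105) ^ suc m         ≡⟨ ^-*-assoc s 105 (suc m) ⟩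
    s ^ (105 * suc m)         ∎
    where open ≤-Reasoning
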